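{- Let $G$ be a finite simple undirected bipartite graph with $n$ vertices, and let $m$ be a nonnegative integer such that $G$ does not contain more than $m$ pairwise vertex-disjoint $4k$-cycles. Then \[ \operatorname{per}(G)=\begin{cases} (-1)^{n/2}\displaystyle\sum_{z=0}^{m}\frac{4^z}{z!}\sum_{T_z}\det(G\setminus T_z), & \text{if } n \text{ is even},\\[2mm] 0, & \text{if } n \text{ is odd},\end{cases} \] where, for each $z$, the inner sum runs over all ordered tuples $T_z=(R_1,\dots,R_z)$ of $z$ mutually vertex-disjoint $4k$-cycles of $G$.
   Context: For a graph $G$ with vertex set $\{v_1,\dots,v_n\}$, the adjacency matrix $A(G)=(a_{ij})$ is the $n\times n$ matrix with $a_{ij}=1$ if $v_i$ and $v_j$ are adjacent and $a_{ij}=0$ otherwise. $\det(G)$ and $\operatorname{per}(G)$ denote the determinant and permanent of $A(G)$, where $\operatorname{per}(M)=\sum_{\sigma\in S_n}\prod_{i=1}^n a_{i,\sigma(i)}$. A cycle of length $l$ is a sequence of distinct vertices $u_1,\dots,u_l$ with $u_i\sim u_{i+1}$ for $i<l$ and $u_l\sim u_1$ (considered as a subgraph); a $4k$-cycle is a cycle whose length is a positive multiple of $4$. For a tuple $T_z$ of vertex-disjoint cycles, $\det(G\setminus T_z)$ denotes the determinant of the principal submatrix of $A(G)$ obtained by deleting the rows and columns corresponding to all vertices lying on the cycles of $T_z$ (the determinant of the empty matrix being $1$). For $z=0$ the only tuple is the empty tuple $T_0$, so the $z=0$ term is $\det(G)$. -}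

module Defs where

open import Level using (Level; 0ℓ)
open import Data.Bool using (Bool; if_then_else_)
open import Data.Empty using (⊥)
open import Data.Fin as Fin using (Fin)
import Data.Fin.Properties as Fin
open import Data.Integer as ℤ using (ℤ; +_; 0ℤ; 1ℤ; -1ℤ)
open import Data.List as List
  using (List; []; _∷_; _∷ʳ_; allFin; cartesianProduct; cartesianProductWith;
         concatMap; deduplicate; filter; length; upTo; zip)
open import Data.List.Membership.Propositional using (_∈_)
import Data.List.Membership.DecPropositional as DecMembership
open import Data.List.Relation.Binary.Disjoint.Propositional using (Disjoint)
open import Data.List.Relation.Binary.Disjoint.DecPropositional using (disjoint?)
open import Data.List.Relation.Unary.Linked as Linked using (Linked)
open import Data.List.Relation.Unary.Unique.Propositional using (Unique)
import Data.List.Relation.Unary.Unique.DecPropositional as DecUnique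
open import Data.Nat as ℕ using (ℕ; zero; suc; _!)
open import Data.Nat.Divisibility using (_∣_; _∣?_)
open import Data.Nat.Properties using (_!≢0)
open import Data.Product using (_×_; _,_; Σ-syntax)
open import Data.Product.Properties using (≡-dec)
open import Data.Rational as ℚ using (ℚ; 0ℚ)
open import Data.Sum using (_⊎_)
open import Data.Vec as Vec using (Vec; []; _∷_)
import Data.Vec.Relation.Unary.All as VecAll
import Data.Vec.Relation.Unary.AllPairs as VecAllPairs
import Data.Vec.Relation.Unary.Any as VecAny
open import Function using (_⇔_; mk⇔; Equivalence)
open import Relation.Binary using (Rel; Decidable; Symmetric; Irreflexive)
open import Relation.Binary.PropositionalEquality using (_≡_; _≢_)
open import Relation.Nullary using (Dec; ¬?; does; no)
open import Relation.Nullary.Decidable using (map′; _×-dec_; _⊎-dec_; _→-dec_)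
import Relation.Unary as U

private
  variable
    a : Level
    A : Set a
    n : ℕ

∑ℤ : List A → (A → ℤ) → ℤ
∑ℤ xs f = List.foldr (λ x s → f x ℤ.+ s) 0ℤ xs

∑ℚ : List A → (A → ℚ) → ℚ
∑ℚ xs f = List.foldr (λ x s → f x ℚ.+ s) 0ℚ xs

∏ℤ : List A → (A → ℤ) → ℤ
∏ℤ xs f = List.foldr (λ x p → f x ℤ.* p) 1ℤ xs

tuples : (k : ℕ) → List A → List (Vec A k)
tuples zero    xs = [] ∷ []
tuples (suc k) xs = cartesianProductWith _∷_ xs (tuples k xs)

-- Elements of Sₙ are written in one-line notation: the vector σ sends i to
-- lookup σ i, and it is a permutation iff its entries are distinct.
permutations : (n : ℕ) → List (Vec (Fin n) n)
permutations n =
  filter (VecAllPairs.allPairs? (λ i j → ¬? (i Fin.≟ j))) (tuples n (allFin n))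

inversions : Vec (Fin n) n → ℕ
inversions {n} σ = length (filter
  (λ (i , j) → (i Fin.<? j) ×-dec (Vec.lookup σ j Fin.<? Vec.lookup σ i))
  (cartesianProduct (allFin n) (allFin n)))

sgn : Vec (Fin n) n → ℤ
sgn σ = -1ℤ ℤ.^ inversions σ

Matrix : ℕ → Set
Matrix n = Fin n → Fin n → ℤ

det : Matrix n → ℤ
det {n} M =
  ∑ℤ (permutations n) λ σ → sgn σ ℤ.* ∏ℤ (allFin n) λ i → M i (Vec.lookup σ i)

per : Matrix n → ℤ
per {n} M =
  ∑ℤ (permutations n) λ σ → ∏ℤ (allFin n) λ i → M i (Vec.lookup σ i)

principalSubmatrix : Matrix n → (is : List (Fin n)) → Matrix (length is)
principalSubmatrix M is i j = M (List.lookup is i) (List.lookup is j)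

record Graph (n : ℕ) : Set₁ where
  infix 4 _~_ _~?_
  field
    _~_      : Rel (Fin n) 0ℓ
    _~?_     : Decidable _~_
    ~-sym    : Symmetric _~_
    ~-irrefl : Irreflexive _≡_ _~_

-- A cycle u₁, …, uₗ is given by its list of vertices; the subgraph it traces
-- out has these vertices and the edges u₁u₂, …, uₗ₋₁uₗ, uₗu₁.
edges : List (Fin n) → List (Fin n × Fin n)
edges []       = []
edges (u ∷ us) = zip (u ∷ us) (us ∷ʳ u)

HasEdge : List (Fin n) → Fin n → Fin n → Set
HasEdge R u v = (u , v) ∈ edges R ⊎ (v , u) ∈ edges R

SameSubgraph : Rel (List (Fin n)) 0ℓ
SameSubgraph R S =
  (∀ v → v ∈ R ⇔ v ∈ S) × (∀ u v → HasEdge R u v ⇔ HasEdge S u v)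

module _ {n : ℕ} where
  open DecMembership (Fin._≟_ {n}) public using () renaming (_∈?_ to _∈ᵥ?_)
  open DecMembership (≡-dec (Fin._≟_ {n}) (Fin._≟_ {n})) using (_∈?_)

  hasEdge? : (R : List (Fin n)) → Decidable (HasEdge R)
  hasEdge? R u v = ((u , v) ∈? edges R) ⊎-dec ((v , u) ∈? edges R)

  sameSubgraph? : Decidable (SameSubgraph {n})
  sameSubgraph? R S =
    Fin.all? (λ v → (v ∈ᵥ? R) ⇔? (v ∈ᵥ? S)) ×-dec
    Fin.all? (λ u → Fin.all? λ v → hasEdge? R u v ⇔? hasEdge? S u v)
    where
    _⇔?_ : {P Q : Set} → Dec P → Dec Q → Dec (P ⇔ Q)
    p? ⇔? q? = map′ (λ (f , g) → mk⇔ f g)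
                    (λ e → Equivalence.to e , Equivalence.from e)
                    ((p? →-dec q?) ×-dec (q? →-dec p?))

module _ {n : ℕ} (G : Graph n) where
  open Graph G

  adjacencyMatrix : Matrix n
  adjacencyMatrix u v = if does (u ~? v) then 1ℤ else 0ℤ

  Bipartite : Set
  Bipartite = Σ[ colour ∈ (Fin n → Bool) ] (∀ {u v} → u ~ v → colour u ≢ colour v)

  IsCycle : List (Fin n) → Set
  IsCycle []       = ⊥
  IsCycle (u ∷ us) = Unique (u ∷ us) × Linked _~_ (u ∷ us ∷ʳ u)

  isCycle? : U.Decidable IsCycle
  isCycle? []       = no λ ()
  isCycle? (u ∷ us) =
    DecUnique.unique? Fin._≟_ (u ∷ us) ×-dec Linked.linked? _~?_ (u ∷ us ∷ʳ u)

  -- Cycles are non-empty, so the length is a positive multiple of 4.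
  Is4kCycle : List (Fin n) → Set
  Is4kCycle R = IsCycle R × 4 ∣ length R

  is4kCycle? : U.Decidable Is4kCycle
  is4kCycle? R = isCycle? R ×-dec (4 ∣? length R)

  -- One vertex sequence for each subgraph that is a 4k-cycle.  The vertices of
  -- a cycle are distinct, so its length is at most n.
  4kCycles : List (List (Fin n))
  4kCycles = deduplicate sameSubgraph? (filter is4kCycle?
    (concatMap (λ l → List.map Vec.toList (tuples l (allFin n))) (upTo (suc n))))

  disjointTuples : (z : ℕ) → List (Vec (List (Fin n)) z)
  disjointTuples z = filter (VecAllPairs.allPairs? (disjoint? Fin._≟_)) (tuples z 4kCycles)

  AtMostDisjoint4kCycles : ℕ → Set
  AtMostDisjoint4kCycles m = ∀ {z} (T : Vec (List (Fin n)) z) →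
    VecAll.All Is4kCycle T → VecAllPairs.AllPairs Disjoint T → z ℕ.≤ m

  remainingVertices : ∀ {z} → Vec (List (Fin n)) z → List (Fin n)
  remainingVertices T = filter (λ v → ¬? (VecAny.any? (v ∈ᵥ?_) T)) (allFin n)

  perG : ℤ
  perG = per adjacencyMatrix

  det-∖ : ∀ {z} → Vec (List (Fin n)) z → ℤ
  det-∖ T = det (principalSubmatrix adjacencyMatrix (remainingVertices T))

4^_/! : ℕ → ℚ
4^ z /! = (+ (4 ℕ.^ z) ℚ./ (z !)) {{z !≢0}}

fromℤ : ℤ → ℚ
fromℤ i = i ℚ./ 1

{-# OPTIONS --safe #-}

-- Write D(S) and P(S) for the determinant and permanent of the subgraph induced
-- on S, and fix v ∈ S.  Expanding along the directed cycles C of G[S] through v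
-- (an edge counts as a 2-cycle) gives P(S) = Σ_C P(S ∖ C), and, all cycles being
-- even, D(S) = − Σ_C D(S ∖ C).  Let f_z(S) be the sum of D(S ∖ T) over the
-- ordered z-tuples T of disjoint 4k-cycles in S.  Sorting the tuples by whether
-- they meet v,
--   f_z(S) = z Σ_{R ∋ v} f_{z−1}(S ∖ R) − Σ_C f_z(S ∖ C),
-- where R runs over the undirected 4k-cycles, each of which is two directed ones.
-- For F(S) = Σ_z 4ᶻ/z! f_z(S) this becomes F(S) = Σ_C (2·[4 ∣ |C|] − 1) F(S ∖ C).
-- As 2·[4 ∣ |C|] − 1 = (−1)^(|C|/2), the function (−1)^(|S|/2) F(S) satisfies
-- the recursion of P(S), so the two agree by induction on |S|.

module Submission where

open import Defs
open import Algebra.Bundles using (CommutativeMonoid)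
import Algebra.Properties.CommutativeSemigroup as CommutativeSemigroup
open import Data.Bool using (if_then_else_)
open import Data.Bool.Properties using (¬-not)
open import Data.Fin as Fin using (Fin; zero; suc)
import Data.Fin.Properties as Fin
open import Data.Integer as ℤ using (ℤ; 0ℤ; 1ℤ; -1ℤ; _+_; _*_; -_)
import Data.Integer.Properties as ℤ
open import Data.Integer.Tactic.RingSolver using (solve-∀)
open import Data.List hiding (find)
open import Data.List.Membership.Propositional using (_∈_; _∉_; find; lose)
open import Data.List.Membership.Propositional.Properties
open import Data.List.Properties
open import Data.List.Relation.Binary.Disjoint.DecPropositional using (disjoint?)
open import Data.List.Relation.Binary.Disjoint.Propositional using (Disjoint)
open import Data.List.Relation.Binary.Permutation.Propositional as ↭
  using (_↭_; ↭-refl; ↭-sym; ↭-trans; prep; swap; ↭⇒↭ₛ)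
open import Data.List.Relation.Binary.Permutation.Propositional.Properties
  using (↭-length; filter-↭; ++-comm; ∷↭∷ʳ; ↭-reverse; ∈-resp-↭; All-resp-↭)
import Data.List.Relation.Binary.Permutation.Setoid.Properties as ↭ₛ
open import Data.List.Relation.Unary.All as All using (All; []; _∷_)
import Data.List.Relation.Unary.All.Properties as All
open import Data.List.Relation.Unary.AllPairs as AllPairs using (AllPairs; []; _∷_)
import Data.List.Relation.Unary.AllPairs.Properties as AllPairs
open import Data.List.Relation.Unary.Any using (here; there)
import Data.List.Relation.Unary.Any.Properties as Any
open import Data.List.Relation.Unary.Linked as Linked using (Linked; [-]; _∷_)
open import Data.List.Relation.Unary.Unique.DecPropositional using (unique?)
open import Data.List.Relation.Unary.Unique.Propositional using (Unique)
open import Data.List.Relation.Unary.Unique.Propositional.Properties as Unique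
  using (Unique[x∷xs]⇒x∉xs; allFin⁺)
open import Data.Nat as ℕ using (ℕ; zero; suc; _≤_; z≤n; s≤s; _/_; _!)
open import Data.Nat.Divisibility
  using (_∣_; divides; _∣?_; ∣⇒≤; ∣m+n∣m⇒∣n; ∣m∣n⇒∣m+n; ∣-refl; _∣0)
import Data.Nat.DivMod as ℕ
import Data.Nat.Properties as ℕ
open import Data.Product as × using (_×_; _,_; proj₁; proj₂; ∃-syntax; uncurry)
open import Data.Rational as ℚ using (ℚ; 0ℚ)
import Data.Rational.Properties as ℚ
open import Data.Rational.Unnormalised as ℚᵘ using (mkℚᵘ; *≡*)
import Data.Rational.Unnormalised.Properties as ℚᵘ
open import Data.Sum as Sum using (_⊎_; inj₁; inj₂)
open import Data.Vec as Vec using (Vec; []; _∷_)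
import Data.Vec.Properties as Vec
import Data.Vec.Relation.Unary.All as VecAll
import Data.Vec.Relation.Unary.All.Properties as VecAll
import Data.Vec.Relation.Unary.AllPairs as VecAllPairs
import Data.Vec.Relation.Unary.Any as VecAny
open import Function using (_∘_; id; mk⇔; Equivalence)
open import Level using (Level)
open import Relation.Binary using (Rel)
open import Relation.Binary.PropositionalEquality
open import Relation.Nullary hiding (det)
open import Relation.Nullary.Decidable using (_×-dec_; dec-true; dec-false)
open import Relation.Unary using (Decidable)

-- The Leibniz sum does not display the cycle of a permutation through a given vertex, so
-- determinant and permanent are both rewritten as an iterated Laplace expansion `minor q`, with q =
-- -1 or q = 1. The key is to let the first row and the first column differ: rows u ∷ S against
-- columns v ∷ S. Expanding row u either closes a path at v or picks some w in S. Once row w has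
-- been moved to the top, the remaining minor has the same shape with w in place of u. Iterating
-- traces a path from u to v, and u = v yields the expansion along directed cycles for both values
-- of q at once. The constant 4 arises as 2 · 2: turning the coefficient -1 of a 4k-cycle into +1
-- costs 2 per directed cycle, hence 4 per undirected one. The factor z for the position within the
-- tuple is cancelled by the factorial, since z · 4ᶻ/z! = 4 · 4ᶻ⁻¹/(z-1)!. This step lowers z by
-- one, so the series cut off at m is first continued to m + 1, where no tuple exists.

private
  module ℤ+ = CommutativeSemigroup (CommutativeMonoid.commutativeSemigroup ℤ.+-0-commutativeMonoid)
  module ℤ* = CommutativeSemigroup (CommutativeMonoid.commutativeSemigroup ℤ.*-1-commutativeMonoid)
  module ℚ+ = CommutativeSemigroup (CommutativeMonoid.commutativeSemigroup ℚ.+-0-commutativeMonoid)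
  module ℚ* = CommutativeSemigroup (CommutativeMonoid.commutativeSemigroup ℚ.*-1-commutativeMonoid)

  variable
    a b c : Level
    A B C : Set a
    P Q : Set a
    n k N : ℕ

-- Finite sums and indicators

∑-cong-∈ : (xs : List A) {f g : A → ℤ} → (∀ {x} → x ∈ xs → f x ≡ g x) → ∑ℤ xs f ≡ ∑ℤ xs g
∑-cong-∈ []       eq = refl
∑-cong-∈ (x ∷ xs) eq = cong₂ _+_ (eq (here refl)) (∑-cong-∈ xs (eq ∘ there))

∑-cong : (xs : List A) {f g : A → ℤ} → (∀ x → f x ≡ g x) → ∑ℤ xs f ≡ ∑ℤ xs g
∑-cong xs eq = ∑-cong-∈ xs (λ {x} _ → eq x)

∑-zero : (xs : List A) {f : A → ℤ} → (∀ {x} → x ∈ xs → f x ≡ 0ℤ) → ∑ℤ xs f ≡ 0ℤ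
∑-zero []       eq = refl
∑-zero (x ∷ xs) eq = cong₂ _+_ (eq (here refl)) (∑-zero xs (eq ∘ there))

∑-+ : (xs : List A) (f g : A → ℤ) → ∑ℤ xs (λ x → f x + g x) ≡ ∑ℤ xs f + ∑ℤ xs g
∑-+ []       f g = refl
∑-+ (x ∷ xs) f g = trans (cong (f x + g x +_) (∑-+ xs f g)) (ℤ+.interchange (f x) (g x) _ _)

∑-* : (k : ℤ) (xs : List A) (f : A → ℤ) → ∑ℤ xs (λ x → k * f x) ≡ k * ∑ℤ xs f
∑-* k []       f = sym (ℤ.*-zeroʳ k)
∑-* k (x ∷ xs) f = trans (cong (k * f x +_) (∑-* k xs f)) (sym (ℤ.*-distribˡ-+ k (f x) _))

∑-swap : (xs : List A) (ys : List B) (f : A → B → ℤ) →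
         ∑ℤ xs (λ x → ∑ℤ ys (f x)) ≡ ∑ℤ ys (λ y → ∑ℤ xs (λ x → f x y))
∑-swap []       ys f = sym (∑-zero ys (λ _ → refl))
∑-swap (x ∷ xs) ys f = trans (cong (∑ℤ ys (f x) +_) (∑-swap xs ys f)) (sym (∑-+ ys (f x) _))

∑-++ : (xs ys : List A) (f : A → ℤ) → ∑ℤ (xs ++ ys) f ≡ ∑ℤ xs f + ∑ℤ ys f
∑-++ []       ys f = sym (ℤ.+-identityˡ _)
∑-++ (x ∷ xs) ys f = trans (cong (f x +_) (∑-++ xs ys f)) (sym (ℤ.+-assoc (f x) _ _))

∑-map : (h : A → B) (xs : List A) (f : B → ℤ) → ∑ℤ (map h xs) f ≡ ∑ℤ xs (f ∘ h)
∑-map h []       f = refl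
∑-map h (x ∷ xs) f = cong (f (h x) +_) (∑-map h xs f)

∑-concatMap : (h : A → List B) (xs : List A) (f : B → ℤ) →
              ∑ℤ (concatMap h xs) f ≡ ∑ℤ xs (λ x → ∑ℤ (h x) f)
∑-concatMap h []       f = refl
∑-concatMap h (x ∷ xs) f = trans (∑-++ (h x) _ f) (cong (∑ℤ (h x) f +_) (∑-concatMap h xs f))

∑-cartesianProductWith : (h : A → B → C) (xs : List A) (ys : List B) (f : C → ℤ) →
  ∑ℤ (cartesianProductWith h xs ys) f ≡ ∑ℤ xs (λ x → ∑ℤ ys (λ y → f (h x y)))
∑-cartesianProductWith h []       ys f = refl
∑-cartesianProductWith h (x ∷ xs) ys f = trans (∑-++ (map (h x) ys) _ f)
  (cong₂ _+_ (∑-map (h x) ys f) (∑-cartesianProductWith h xs ys f))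

-- Conditions are carried as factors 0 or 1 rather than by filtering: the sums then run over fixed
-- lists, so they can be interchanged, and conditions are regrouped by multiplication.
𝟙 : Dec P → ℤ
𝟙 d = if does d then 1ℤ else 0ℤ

𝟙-yes : (d : Dec P) → P → 𝟙 d ≡ 1ℤ
𝟙-yes d p = cong (if_then 1ℤ else 0ℤ) (dec-true d p)

𝟙-no : (d : Dec P) → ¬ P → 𝟙 d ≡ 0ℤ
𝟙-no d ¬p = cong (if_then 1ℤ else 0ℤ) (dec-false d ¬p)

𝟙-cong : (d : Dec P) (e : Dec Q) → (P → Q) → (Q → P) → 𝟙 d ≡ 𝟙 e
𝟙-cong (yes p) e f g = sym (𝟙-yes e (f p))
𝟙-cong (no ¬p) e f g = sym (𝟙-no e (¬p ∘ g))

𝟙-× : (d : Dec P) (e : Dec Q) → 𝟙 (d ×-dec e) ≡ 𝟙 d * 𝟙 e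
𝟙-× (yes _) (yes _) = refl
𝟙-× (yes _) (no _)  = refl
𝟙-× (no _)  _       = refl

𝟙-*-cong : (d : Dec P) {x y : ℤ} → (P → x ≡ y) → 𝟙 d * x ≡ 𝟙 d * y
𝟙-*-cong (yes p) eq = cong (1ℤ *_) (eq p)
𝟙-*-cong (no _)  eq = refl

𝟙-*-yes : (d : Dec P) → P → (x : ℤ) → 𝟙 d * x ≡ x
𝟙-*-yes d p x = trans (cong (_* x) (𝟙-yes d p)) (ℤ.*-identityˡ x)

𝟙-*-no : (d : Dec P) → ¬ P → (x : ℤ) → 𝟙 d * x ≡ 0ℤ
𝟙-*-no d ¬p x = cong (_* x) (𝟙-no d ¬p)

∑-filter : {P : A → Set b} (P? : Decidable P) (xs : List A) (f : A → ℤ) →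
           ∑ℤ (filter P? xs) f ≡ ∑ℤ xs (λ x → 𝟙 (P? x) * f x)
∑-filter P? []       f = refl
∑-filter P? (x ∷ xs) f with P? x
... | yes _ = cong₂ _+_ (sym (ℤ.*-identityˡ (f x))) (∑-filter P? xs f)
... | no _  = trans (∑-filter P? xs f) (sym (ℤ.+-identityˡ _))

∑-single : {P : A → Set b} (P? : Decidable P) {xs : List A} → Unique xs →
           ∀ {c} → c ∈ xs → P c → (∀ {x} → x ∈ xs → P x → x ≡ c) → (f : A → ℤ) →
           ∑ℤ xs (λ x → 𝟙 (P? x) * f x) ≡ f c
∑-single P? {x ∷ xs} (x≢ ∷ u) (here refl) pc only f = trans
  (cong₂ _+_ (𝟙-*-yes (P? x) pc (f x))
    (∑-zero xs (λ {y} y∈ → 𝟙-*-no (P? y) (λ py → All.lookup x≢ y∈ (sym (only (there y∈) py))) (f y))))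
  (ℤ.+-identityʳ (f x))
∑-single P? {x ∷ xs} (x≢ ∷ u) (there c∈) pc only f = trans
  (cong₂ _+_ (𝟙-*-no (P? x) (λ px → All.lookup x≢ c∈ (only (here refl) px)) (f x))
             (∑-single P? u c∈ pc (only ∘ there) f))
  (ℤ.+-identityˡ _)

∑-double : {P : A → Set b} (P? : Decidable P) {xs : List A} → Unique xs →
           ∀ {c d} → c ∈ xs → P c → d ∈ xs → P d → c ≢ d →
           (∀ {x} → x ∈ xs → P x → x ≡ c ⊎ x ≡ d) → (f : A → ℤ) →
           ∑ℤ xs (λ x → 𝟙 (P? x) * f x) ≡ f c + f d
∑-double {P = P} P? {x ∷ xs} (x≢ ∷ u) {c} {d} c∈ pc d∈ pd c≢d only f = go c∈ d∈
  where
  skip : ∀ {y z} → y ∈ xs → x ≡ y → z ≡ y → x ≡ z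
  skip _ p q = trans p (sym q)
  drop-right : ∀ {y} → y ∈ xs → y ≡ x ⊎ y ≡ d → y ≡ d
  drop-right y∈ (inj₁ y≡x) = contradiction (sym y≡x) (All.lookup x≢ y∈)
  drop-right y∈ (inj₂ y≡d) = y≡d
  drop-left : ∀ {y} → y ∈ xs → y ≡ c ⊎ y ≡ x → y ≡ c
  drop-left y∈ (inj₁ y≡c) = y≡c
  drop-left y∈ (inj₂ y≡x) = contradiction (sym y≡x) (All.lookup x≢ y∈)
  go : c ∈ x ∷ xs → d ∈ x ∷ xs → ∑ℤ (x ∷ xs) (λ x → 𝟙 (P? x) * f x) ≡ f c + f d
  go (here refl) (here d≡) = contradiction (sym d≡) c≢d
  go (here refl) (there d∈) = cong₂ _+_ (𝟙-*-yes (P? x) pc (f x))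
    (∑-single P? u d∈ pd (λ y∈ py → drop-right y∈ (only (there y∈) py)) f)
  go (there c∈) (here refl) = trans (cong₂ _+_ (𝟙-*-yes (P? x) pd (f x))
    (∑-single P? u c∈ pc (λ y∈ py → drop-left y∈ (only (there y∈) py)) f)) (ℤ.+-comm (f x) (f c))
  go (there c∈) (there d∈) = trans
    (cong₂ _+_ (𝟙-*-no (P? x) (λ px → neither (only (here refl) px)) (f x))
               (∑-double P? u c∈ pc d∈ pd c≢d (only ∘ there) f))
    (ℤ.+-identityˡ _)
    where
    neither : ¬ (x ≡ c ⊎ x ≡ d)
    neither (inj₁ refl) = All.lookup x≢ c∈ refl
    neither (inj₂ refl) = All.lookup x≢ d∈ refl

-- Differences of lists

filter-filter : {P : A → Set a} {Q : A → Set b} {R : A → Set c}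
  (P? : Decidable P) (Q? : Decidable Q) (R? : Decidable R) →
  (∀ {x} → P x → Q x → R x) → (∀ {x} → R x → P x × Q x) →
  (xs : List A) → filter P? (filter Q? xs) ≡ filter R? xs
filter-filter P? Q? R? f g [] = refl
filter-filter P? Q? R? f g (x ∷ xs) with Q? x
... | no ¬q = trans (filter-filter P? Q? R? f g xs) (sym (filter-reject R? (¬q ∘ proj₂ ∘ g)))
... | yes q with P? x
...   | yes p = trans (cong (x ∷_) (filter-filter P? Q? R? f g xs)) (sym (filter-accept R? (f p q)))
...   | no ¬p = trans (filter-filter P? Q? R? f g xs) (sym (filter-reject R? (¬p ∘ proj₁ ∘ g)))

infixl 6 _∖_
_∖_ : List (Fin n) → List (Fin n) → List (Fin n)
S ∖ R = filter (λ x → ¬? (x ∈ᵥ? R)) S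

∈-∖⁺ : ∀ {S R : List (Fin n)} {x} → x ∈ S → x ∉ R → x ∈ S ∖ R
∈-∖⁺ {R = R} x∈ x∉ = ∈-filter⁺ (λ x → ¬? (x ∈ᵥ? R)) x∈ x∉

∈-∖⁻ : ∀ (S R : List (Fin n)) {x} → x ∈ S ∖ R → x ∈ S × x ∉ R
∈-∖⁻ S R = ∈-filter⁻ (λ x → ¬? (x ∈ᵥ? R))

∖-unique : ∀ {S : List (Fin n)} R → Unique S → Unique (S ∖ R)
∖-unique R = Unique.filter⁺ (λ x → ¬? (x ∈ᵥ? R))

∖-∷ : ∀ (S : List (Fin n)) w p → S ∖ (w ∷ []) ∖ p ≡ S ∖ (w ∷ p)
∖-∷ S w p = filter-filter _ _ _
  (λ { x∉p x∉w (here refl) → x∉w (here refl) ; x∉p x∉w (there x∈p) → x∉p x∈p })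
  (λ x∉ → x∉ ∘ there , λ { (here refl) → x∉ (here refl) }) S

∖-comm : ∀ (S Q R : List (Fin n)) → S ∖ Q ∖ R ≡ S ∖ R ∖ Q
∖-comm S Q R = trans
  (filter-filter _ _ (λ x → ¬? (x ∈ᵥ? Q) ×-dec ¬? (x ∈ᵥ? R)) (λ r q → q , r) (λ (q , r) → r , q) S)
  (sym (filter-filter _ _ _ _,_ id S))

∖-[] : (S : List (Fin n)) → S ∖ [] ≡ S
∖-[] S = filter-all _ (All.tabulate (λ _ ()))

∖-self : (S : List (Fin n)) {R : List (Fin n)} → All (_∉ R) S → S ∖ R ≡ S
∖-self S {R} = filter-all (λ x → ¬? (x ∈ᵥ? R))

∖-∷-∉ : ∀ {v} (S : List (Fin n)) {R} → v ∉ R → (v ∷ S) ∖ R ≡ v ∷ (S ∖ R)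
∖-∷-∉ S {R} = filter-accept (λ x → ¬? (x ∈ᵥ? R))

∖-∷-∈ : ∀ {v} (S : List (Fin n)) {R} → v ∈ R → (v ∷ S) ∖ R ≡ S ∖ R
∖-∷-∈ S {R} v∈R = filter-reject (λ x → ¬? (x ∈ᵥ? R)) (λ v∉R → v∉R v∈R)

∷-∖-head : ∀ {v} {S : List (Fin n)} → Unique (v ∷ S) → (v ∷ S) ∖ (v ∷ []) ≡ S
∷-∖-head {S = S} (v≢ ∷ _) = trans (∖-∷-∈ S (here refl))
  (∖-self S (All.tabulate (λ { x∈S (here refl) → All.lookup v≢ x∈S refl })))

∷-∖-tail : ∀ {v w} {S : List (Fin n)} → Unique (v ∷ S) → w ∈ S → (v ∷ S) ∖ (w ∷ []) ≡ v ∷ (S ∖ (w ∷ []))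
∷-∖-tail {S = S} (v≢ ∷ _) w∈S = ∖-∷-∉ S (λ { (here v≡w) → All.lookup v≢ w∈S v≡w })

↭-extract : ∀ {S : List (Fin n)} {w} → Unique S → w ∈ S → S ↭ w ∷ (S ∖ (w ∷ []))
↭-extract {S = v ∷ S} u (here refl) = ↭.↭-reflexive (cong (v ∷_) (sym (∷-∖-head u)))
↭-extract {S = v ∷ S} u@(_ ∷ uS) (there w∈S) = ↭-trans (prep v (↭-extract uS w∈S))
  (↭-trans (swap v _ ↭-refl) (↭.↭-reflexive (cong (_ ∷_) (sym (∷-∖-tail u w∈S)))))

↭-split : ∀ {S R : List (Fin n)} → Unique S → Unique R → All (_∈ S) R → S ↭ R ++ (S ∖ R)
↭-split {S = S} uS [] [] = ↭.↭-reflexive (sym (∖-[] S))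
↭-split {S = S} {w ∷ R} uS (w≢ ∷ uR) (w∈S ∷ R⊆S) = ↭-trans (↭-extract uS w∈S) (prep w
  (↭-trans (↭-split (∖-unique _ uS) uR R⊆)
    (↭.↭-reflexive (cong (R ++_) (∖-∷ S w R)))))
  where
  R⊆ : All (_∈ S ∖ (w ∷ [])) R
  R⊆ = All.tabulate (λ x∈R → ∈-∖⁺ (All.lookup R⊆S x∈R) λ { (here refl) → All.lookup w≢ x∈R refl })

length-∖ : ∀ {S R : List (Fin n)} → Unique S → Unique R → All (_∈ S) R →
           length S ≡ length R ℕ.+ length (S ∖ R)
length-∖ {R = R} uS uR R⊆S = trans (↭-length (↭-split uS uR R⊆S)) (length-++ R)

length-≤ : ∀ {S R : List (Fin n)} → Unique S → Unique R → All (_∈ S) R → length R ≤ length S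
length-≤ uS uR R⊆S = subst (_ ≤_) (sym (length-∖ uS uR R⊆S)) (ℕ.m≤m+n _ _)

-- `S` splits into `R` and a remainder, and equal lengths leave the remainder empty.
↭-full : ∀ {S R : List (Fin n)} → Unique S → Unique R → All (_∈ S) R → length R ≡ length S → R ↭ S
↭-full {S = S} {R} uS uR R⊆S eq = ↭-sym (↭-trans (↭-split uS uR R⊆S)
  (↭.↭-reflexive (trans (cong (R ++_) (empty (S ∖ R) rest)) (++-identityʳ R))))
  where
  rest : length (S ∖ R) ≡ 0
  rest = ℕ.+-cancelˡ-≡ (length R) _ _ (trans (sym (length-∖ uS uR R⊆S)) (trans (sym eq) (sym (ℕ.+-identityʳ _))))
  empty : (xs : List (Fin _)) → length xs ≡ 0 → xs ≡ []
  empty [] _ = refl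

-- Determinants and permanents by Laplace expansion

-- This is the sum of qⁱ φ(cᵢ, ds) over the positions i of the list, where ds is the list with cᵢ
-- deleted and the order of the other entries kept.
expand : ℤ → (A → List A → ℤ) → List A → ℤ
expand q φ []       = 0ℤ
expand q φ (c ∷ cs) = φ c cs + q * expand q (λ d ds → φ d (c ∷ ds)) cs

-- q = −1 gives determinants and q = 1 gives permanents.
minor : ℤ → (A → B → ℤ) → List A → List B → ℤ
minor q M []       cs = 1ℤ
minor q M (r ∷ rs) cs = expand q (λ c ds → M r c * minor q M rs ds) cs

expand-cong : ∀ q {φ ψ : A → List A → ℤ} → (∀ c ds → φ c ds ≡ ψ c ds) → ∀ cs → expand q φ cs ≡ expand q ψ cs
expand-cong q eq []       = refl
expand-cong q eq (c ∷ cs) = cong₂ (λ x y → x + q * y) (eq c cs) (expand-cong q (λ d ds → eq d (c ∷ ds)) cs)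

expand-+ : ∀ q (φ ψ : A → List A → ℤ) cs → expand q (λ c ds → φ c ds + ψ c ds) cs ≡ expand q φ cs + expand q ψ cs
expand-+ q φ ψ []       = refl
expand-+ q φ ψ (c ∷ cs) = trans
  (cong (λ y → φ c cs + ψ c cs + q * y) (expand-+ q (λ d ds → φ d (c ∷ ds)) (λ d ds → ψ d (c ∷ ds)) cs))
  (lemma q (φ c cs) (ψ c cs) _ _)
  where
  lemma : ∀ q x y z w → (x + y) + q * (z + w) ≡ (x + q * z) + (y + q * w)
  lemma = solve-∀

expand-* : ∀ q k (φ : A → List A → ℤ) cs → expand q (λ c ds → k * φ c ds) cs ≡ k * expand q φ cs
expand-* q k φ []       = sym (ℤ.*-zeroʳ k)
expand-* q k φ (c ∷ cs) = trans
  (cong (λ y → k * φ c cs + q * y) (expand-* q k (λ d ds → φ d (c ∷ ds)) cs))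
  (lemma q k (φ c cs) _)
  where
  lemma : ∀ q k x z → k * x + q * (k * z) ≡ k * (x + q * z)
  lemma = solve-∀

expand-map : ∀ q (f : A → B) (φ : B → List B → ℤ) cs →
             expand q φ (map f cs) ≡ expand q (λ c ds → φ (f c) (map f ds)) cs
expand-map q f φ []       = refl
expand-map q f φ (c ∷ cs) = cong (λ y → φ (f c) (map f cs) + q * y) (expand-map q f (λ d ds → φ d (f c ∷ ds)) cs)

minor-map : ∀ q {A' : Set a} {B' : Set b} (M : A → B → ℤ) (f : A' → A) (g : B' → B) rs cs →
            minor q M (map f rs) (map g cs) ≡ minor q (λ i j → M (f i) (g j)) rs cs
minor-map q M f g []       cs = refl
minor-map q M f g (r ∷ rs) cs = trans (expand-map q g _ cs)
  (expand-cong q (λ c ds → cong (M (f r) (g c) *_) (minor-map q M f g rs ds)) cs)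

module _ {q : ℤ} (q² : q * q ≡ 1ℤ) where

  private
    q*q* : ∀ x → q * (q * x) ≡ x
    q*q* x = trans (sym (ℤ.*-assoc q q x)) (trans (cong (_* x) q²) (ℤ.*-identityˡ x))

  -- Picking two entries in the opposite order moves the position of exactly one of them by one,
  -- which is one factor `q`. As `q * q ≡ 1ℤ`, it does not matter whether that position goes up or
  -- down. In the induction, the terms are sorted by whether `c` is picked first, second or not at
  -- all.
  expand-expand-swap : (ψ : A → A → List A → ℤ) (cs : List A) →
    expand q (λ c ds → expand q (λ d es → ψ c d es) ds) cs ≡
    q * expand q (λ c ds → expand q (λ d es → ψ d c es) ds) cs
  expand-expand-swap ψ []       = sym (ℤ.*-zeroʳ q)
  expand-expand-swap {A = A} ψ (c ∷ cs) = begin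
    E ψ + q * expand q (λ d ds → ψ d c ds + q * expand q (λ e es → ψ d e (c ∷ es)) ds) cs
      ≡⟨ cong (λ y → E ψ + q * y) (both ψ) ⟩
    E ψ + q * (E ψᵀ + q * F ψ)
      ≡⟨ cong₂ (λ x y → x + q * (E ψᵀ + q * y)) (sym (q*q* (E ψ)))
           (expand-expand-swap (λ d e es → ψ d e (c ∷ es)) cs) ⟩
    q * (q * E ψ) + q * (E ψᵀ + q * (q * F ψᵀ))
      ≡⟨ regroup q (E ψ) (E ψᵀ) (F ψᵀ) ⟩
    q * (E ψᵀ + q * (E ψ + q * F ψᵀ))
      ≡⟨ cong (λ y → q * (E ψᵀ + q * y)) (both ψᵀ) ⟨
    q * (E ψᵀ + q * expand q (λ d ds → ψ c d ds + q * expand q (λ e es → ψ e d (c ∷ es)) ds) cs)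
      ∎
    where
    open ≡-Reasoning
    ψᵀ : A → A → List A → ℤ
    ψᵀ d e = ψ e d
    E F : (A → A → List A → ℤ) → ℤ
    E ψ = expand q (ψ c) cs
    F ψ = expand q (λ d ds → expand q (λ e es → ψ d e (c ∷ es)) ds) cs
    both : ∀ ψ → expand q (λ d ds → ψ d c ds + q * expand q (λ e es → ψ d e (c ∷ es)) ds) cs ≡
                 expand q (λ d → ψ d c) cs + q * F ψ
    both ψ = trans (expand-+ q _ _ cs) (cong (expand q (λ d → ψ d c) cs +_) (expand-* q q _ cs))
    regroup : ∀ q x y z → q * (q * x) + q * (y + q * (q * z)) ≡ q * (y + q * (x + q * z))
    regroup = solve-∀

  -- Once the two rows stand on top, the first two expansions form a double sum over ordered pairs
  -- of columns, to which `expand-expand-swap` applies. Rows above them only contribute linear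
  -- factors.
  minor-swap : (M : A → B → ℤ) (xs : List A) {a b : A} (ys : List A) (cs : List B) →
               minor q M (xs ++ a ∷ b ∷ ys) cs ≡ q * minor q M (xs ++ b ∷ a ∷ ys) cs
  minor-swap M [] {a} {b} ys cs = begin
    expand q (λ c ds → M a c * expand q (λ d es → M b d * minor q M ys es) ds) cs
      ≡⟨ expand-cong q (λ c ds → expand-* q (M a c) _ ds) cs ⟨
    expand q (λ c ds → expand q (λ d es → M a c * (M b d * minor q M ys es)) ds) cs
      ≡⟨ expand-expand-swap (λ c d es → M a c * (M b d * minor q M ys es)) cs ⟩
    q * expand q (λ c ds → expand q (λ d es → M a d * (M b c * minor q M ys es)) ds) cs
      ≡⟨ cong (q *_) (expand-cong q (λ c ds → trans
           (expand-cong q (λ d es → ℤ*.x∙yz≈y∙xz (M a d) (M b c) _) ds)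
           (expand-* q (M b c) _ ds)) cs) ⟩
    q * expand q (λ c ds → M b c * expand q (λ d es → M a d * minor q M ys es) ds) cs
      ∎
    where open ≡-Reasoning
  minor-swap M (x ∷ xs) ys cs = trans
    (expand-cong q (λ c ds → trans (cong (M x c *_) (minor-swap M xs ys ds)) (ℤ*.x∙yz≈y∙xz (M x c) q _)) cs)
    (expand-* q q _ cs)

  -- Moving row w to the front absorbs the sign of the position of w.
  expand-align : (G : A → List A → List A → ℤ) →
    (∀ w ws xs {a b} ys → G w ws (xs ++ a ∷ b ∷ ys) ≡ q * G w ws (xs ++ b ∷ a ∷ ys)) →
    (S : List A) → expand q (λ w ws → G w ws S) S ≡ expand 1ℤ (λ w ws → G w ws (w ∷ ws)) S
  expand-align G alt []       = refl
  expand-align G alt (c ∷ cs) = cong (G c cs (c ∷ cs) +_) (begin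
    q * expand q (λ w ws → G w (c ∷ ws) (c ∷ cs)) cs
      ≡⟨ cong (q *_) (expand-align (λ w ws rs → G w (c ∷ ws) (c ∷ rs)) (λ w ws xs ys → alt w (c ∷ ws) (c ∷ xs) ys) cs) ⟩
    q * expand 1ℤ (λ w ws → G w (c ∷ ws) (c ∷ w ∷ ws)) cs
      ≡⟨ cong (q *_) (trans (expand-cong 1ℤ (λ w ws → alt w (c ∷ ws) [] ws) cs) (expand-* 1ℤ q _ cs)) ⟩
    q * (q * expand 1ℤ (λ w ws → G w (c ∷ ws) (w ∷ c ∷ ws)) cs)
      ≡⟨ q*q* _ ⟩
    expand 1ℤ (λ w ws → G w (c ∷ ws) (w ∷ c ∷ ws)) cs
      ≡⟨ ℤ.*-identityˡ _ ⟨
    1ℤ * expand 1ℤ (λ w ws → G w (c ∷ ws) (w ∷ c ∷ ws)) cs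
      ∎)
    where open ≡-Reasoning

expand-1 : (φ : Fin n → List (Fin n) → ℤ) {S : List (Fin n)} → Unique S →
           expand 1ℤ φ S ≡ ∑ℤ S (λ w → φ w (S ∖ (w ∷ [])))
expand-1 φ {[]}    u = refl
expand-1 φ {c ∷ S} u@(_ ∷ uS) = cong₂ _+_
  (cong (φ c) (sym (∷-∖-head u)))
  (trans (ℤ.*-identityˡ _) (trans (expand-1 (λ d ds → φ d (c ∷ ds)) uS)
    (∑-cong-∈ S (λ w∈S → cong (φ _) (sym (∷-∖-tail u w∈S))))))

-- Choosing column `v` in row `u` leaves the minor on `S`. Choosing `w` in `S` leaves rows `S`
-- against the columns `v` followed by `S` without `w`. Moving row `w` to the top cancels the sign
-- of the position of `w` in `S`; the `q` that remains comes from the column `v` in front.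
minor-step : ∀ {q} → q * q ≡ 1ℤ → (M : Fin n → Fin n → ℤ) (u v : Fin n) {S : List (Fin n)} → Unique S →
  minor q M (u ∷ S) (v ∷ S) ≡
  M u v * minor q M S S + q * ∑ℤ S (λ w → M u w * minor q M (w ∷ (S ∖ (w ∷ []))) (v ∷ (S ∖ (w ∷ []))))
minor-step {q = q} q² M u v {S} uS = cong (λ y → M u v * minor q M S S + q * y) (trans
  (expand-align q² (λ w ws rs → M u w * minor q M rs (v ∷ ws))
    (λ w ws xs ys → trans (cong (M u w *_) (minor-swap q² M xs ys (v ∷ ws))) (ℤ*.x∙yz≈y∙xz (M u w) q _)) S)
  (expand-1 _ uS))

-- The Leibniz formula

rank : Fin n → List (Fin n) → ℕ
rank c S = length (filter (Fin._<? c) S)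

-- In an increasing list the position of an entry is the number of smaller entries. That number
-- depends only on the entries and not on their order, so it can be compared with a count over an
-- arbitrarily ordered tuple.
expand-rank : ∀ q (φ : Fin n → List (Fin n) → ℤ) {S : List (Fin n)} → AllPairs Fin._<_ S →
              expand q φ S ≡ ∑ℤ S (λ w → q ℤ.^ rank w S * φ w (S ∖ (w ∷ [])))
expand-rank q φ {[]}    []         = refl
expand-rank {n} q φ {c ∷ S} (c< ∷ inc) = cong₂ _+_ head≡ tail≡
  where
  u : Unique (c ∷ S)
  u = All.map Fin.<⇒≢ c< ∷ AllPairs.map Fin.<⇒≢ inc
  rank-head : rank c (c ∷ S) ≡ 0
  rank-head = cong length (filter-none (Fin._<? c) (Fin.<-irrefl refl ∷ All.map (λ c<x x<c → Fin.<-asym c<x x<c) c<))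
  rank-tail : ∀ {w} → w ∈ S → rank w (c ∷ S) ≡ suc (rank w S)
  rank-tail {w} w∈S = cong length (filter-accept (Fin._<? w) (All.lookup c< w∈S))
  head≡ : φ c S ≡ q ℤ.^ rank c (c ∷ S) * φ c ((c ∷ S) ∖ (c ∷ []))
  head≡ = sym (trans (cong₂ (λ k R → q ℤ.^ k * φ c R) rank-head (∷-∖-head u)) (ℤ.*-identityˡ _))
  tail≡ : q * expand q (λ d ds → φ d (c ∷ ds)) S ≡
          ∑ℤ S (λ w → q ℤ.^ rank w (c ∷ S) * φ w ((c ∷ S) ∖ (w ∷ [])))
  tail≡ = trans (cong (q *_) (expand-rank q (λ d ds → φ d (c ∷ ds)) inc)) (trans (sym (∑-* q S _))
    (∑-cong-∈ S (λ w∈S → trans (sym (ℤ.*-assoc q _ _))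
      (sym (cong₂ (λ k R → q ℤ.^ k * φ _ R) (rank-tail w∈S) (∷-∖-tail u w∈S))))))

tuples-∈ : ∀ {xs : List A} {k} {τ : Vec A k} → τ ∈ tuples k xs → VecAll.All (_∈ xs) τ
tuples-∈ {τ = []}    _ = VecAll.[]
tuples-∈ {xs = xs} {suc k} {τ = _ ∷ _} τ∈ with ∈-cartesianProductWith⁻ _∷_ xs (tuples k xs) τ∈
... | _ , _ , x∈ , τ′∈ , refl = x∈ VecAll.∷ tuples-∈ τ′∈

toList-Unique : {τ : Vec A k} → VecAllPairs.AllPairs _≢_ τ → Unique (Vec.toList τ)
toList-Unique VecAllPairs.[]       = []
toList-Unique (x≢ VecAllPairs.∷ d) = VecAll.toList⁺ x≢ ∷ toList-Unique d

distinct? : (τ : Vec (Fin N) k) → Dec (VecAllPairs.AllPairs _≢_ τ)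
distinct? = VecAllPairs.allPairs? (λ i j → ¬? (i Fin.≟ j))

-- This turns the demand that all later values of a permutation differ from its first value `c` into
-- a sum over tuples from the list without `c`.
∑-tuples-filter : {P : A → Set b} (P? : Decidable P) (xs : List A) → ∀ k (f : Vec A k → ℤ) →
  ∑ℤ (tuples k (filter P? xs)) f ≡ ∑ℤ (tuples k xs) (λ τ → 𝟙 (VecAll.all? P? τ) * f τ)
∑-tuples-filter P? xs zero    f = cong (_+ 0ℤ) (sym (ℤ.*-identityˡ (f [])))
∑-tuples-filter P? xs (suc k) f = begin
  ∑ℤ (cartesianProductWith _∷_ (filter P? xs) (tuples k (filter P? xs))) f
    ≡⟨ ∑-cartesianProductWith _∷_ (filter P? xs) _ f ⟩
  ∑ℤ (filter P? xs) (λ x → ∑ℤ (tuples k (filter P? xs)) (λ τ → f (x ∷ τ)))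
    ≡⟨ ∑-filter P? xs _ ⟩
  ∑ℤ xs (λ x → 𝟙 (P? x) * ∑ℤ (tuples k (filter P? xs)) (λ τ → f (x ∷ τ)))
    ≡⟨ ∑-cong xs (λ x → trans (cong (𝟙 (P? x) *_) (∑-tuples-filter P? xs k _)) (sym (∑-* (𝟙 (P? x)) (tuples k xs) _))) ⟩
  ∑ℤ xs (λ x → ∑ℤ (tuples k xs) (λ τ → 𝟙 (P? x) * (𝟙 (VecAll.all? P? τ) * f (x ∷ τ))))
    ≡⟨ ∑-cong xs (λ x → ∑-cong (tuples k xs) (λ τ → trans (sym (ℤ.*-assoc (𝟙 (P? x)) _ _))
         (cong (_* f (x ∷ τ)) (trans (sym (𝟙-× (P? x) (VecAll.all? P? τ)))
           (𝟙-cong (P? x ×-dec VecAll.all? P? τ) (VecAll.all? P? (x ∷ τ)) (λ (p , ps) → p VecAll.∷ ps) (λ { (p VecAll.∷ ps) → p , ps })))))) ⟩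
  ∑ℤ xs (λ x → ∑ℤ (tuples k xs) (λ τ → 𝟙 (VecAll.all? P? (x ∷ τ)) * f (x ∷ τ)))
    ≡⟨ ∑-cartesianProductWith _∷_ xs (tuples k xs) (λ τ → 𝟙 (VecAll.all? P? τ) * f τ) ⟨
  ∑ℤ (tuples (suc k) xs) (λ τ → 𝟙 (VecAll.all? P? τ) * f τ)
    ∎
  where open ≡-Reasoning

∑-allFin : (f : Fin (suc k) → ℤ) → ∑ℤ (allFin (suc k)) f ≡ f zero + ∑ℤ (allFin k) (f ∘ suc)
∑-allFin {k} f = cong (f zero +_) (trans (cong (λ xs → ∑ℤ xs f) (sym (map-tabulate id suc))) (∑-map suc (allFin k) f))

∏-allFin : (f : Fin (suc k) → ℤ) → ∏ℤ (allFin (suc k)) f ≡ f zero * ∏ℤ (allFin k) (f ∘ suc)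
∏-allFin {k} f = cong (f zero *_) (trans (cong (λ xs → ∏ℤ xs f) (sym (map-tabulate id suc)))
  (foldr-map (λ x p → f x * p) suc 1ℤ (allFin k)))

∑-lookup : (τ : Vec A k) (f : A → ℤ) → ∑ℤ (allFin k) (f ∘ Vec.lookup τ) ≡ ∑ℤ (Vec.toList τ) f
∑-lookup []      f = refl
∑-lookup (x ∷ τ) f = trans (∑-allFin (f ∘ Vec.lookup (x ∷ τ))) (cong (f x +_) (∑-lookup τ f))

-- Inversions are grouped by their left member, which is how the signs of successive Laplace
-- expansions accumulate.
inv : Vec (Fin N) k → ℕ
inv []      = 0
inv (c ∷ τ) = rank c (Vec.toList τ) ℕ.+ inv τ

count-∑ : {P : A → Set b} (P? : Decidable P) (xs : List A) → ℤ.+ length (filter P? xs) ≡ ∑ℤ xs (λ x → 𝟙 (P? x))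
count-∑ P? []       = refl
count-∑ P? (x ∷ xs) with P? x
... | yes _ = cong (1ℤ +_) (count-∑ P? xs)
... | no  _ = trans (count-∑ P? xs) (sym (ℤ.+-identityˡ _))

inv-∑ : (σ : Vec (Fin N) k) → ∑ℤ (allFin k) (λ i → ∑ℤ (allFin k) (λ j →
          𝟙 ((i Fin.<? j) ×-dec (Vec.lookup σ j Fin.<? Vec.lookup σ i)))) ≡ ℤ.+ inv σ
inv-∑ [] = refl
inv-∑ {k = suc k} (c ∷ τ) = begin
  ∑ℤ (allFin (suc k)) (λ i → ∑ℤ (allFin (suc k)) (λ j → t i j))
    ≡⟨ ∑-allFin (λ i → ∑ℤ (allFin (suc k)) (t i)) ⟩
  ∑ℤ (allFin (suc k)) (λ j → t zero j) + ∑ℤ (allFin k) (λ i → ∑ℤ (allFin (suc k)) (λ j → t (suc i) j))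
    ≡⟨ cong₂ _+_ (∑-allFin (t zero)) (∑-cong (allFin k) (λ i → trans (∑-allFin (t (suc i))) (ℤ.+-identityˡ (∑ℤ (allFin k) (t (suc i) ∘ suc))))) ⟩
  0ℤ + ∑ℤ (allFin k) (λ j → t zero (suc j)) + ∑ℤ (allFin k) (λ i → ∑ℤ (allFin k) (λ j → t (suc i) (suc j)))
    ≡⟨ cong₂ _+_ first≡ rest≡ ⟩
  ℤ.+ rank c (Vec.toList τ) + ℤ.+ inv τ
    ∎
  where
  open ≡-Reasoning
  t : Fin (suc k) → Fin (suc k) → ℤ
  t i j = 𝟙 ((i Fin.<? j) ×-dec (Vec.lookup (c ∷ τ) j Fin.<? Vec.lookup (c ∷ τ) i))
  first≡ : 0ℤ + ∑ℤ (allFin k) (λ j → t zero (suc j)) ≡ ℤ.+ rank c (Vec.toList τ)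
  first≡ = trans (ℤ.+-identityˡ _) (trans
    (∑-cong (allFin k) (λ j → 𝟙-cong ((zero {k} Fin.<? suc j) ×-dec (Vec.lookup τ j Fin.<? c)) (Vec.lookup τ j Fin.<? c) proj₂ (λ lt → s≤s z≤n , lt)))
    (trans (∑-lookup τ (λ y → 𝟙 (y Fin.<? c))) (sym (count-∑ (Fin._<? c) (Vec.toList τ)))))
  rest≡ : ∑ℤ (allFin k) (λ i → ∑ℤ (allFin k) (λ j → t (suc i) (suc j))) ≡ ℤ.+ inv τ
  rest≡ = trans (∑-cong (allFin k) (λ i → ∑-cong (allFin k) (λ j →
    𝟙-cong ((suc i Fin.<? suc j) ×-dec (Vec.lookup τ j Fin.<? Vec.lookup τ i))
           ((i Fin.<? j) ×-dec (Vec.lookup τ j Fin.<? Vec.lookup τ i))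
           (λ { (s≤s p , q) → p , q }) (λ (p , q) → s≤s p , q)))) (inv-∑ τ)

inversions≡inv : (σ : Vec (Fin n) n) → inversions σ ≡ inv σ
inversions≡inv {n} σ = ℤ.+-injective (begin
  ℤ.+ inversions σ
    ≡⟨ count-∑ P? (cartesianProduct (allFin n) (allFin n)) ⟩
  ∑ℤ (cartesianProduct (allFin n) (allFin n)) (λ x → 𝟙 (P? x))
    ≡⟨ ∑-cartesianProductWith _,_ (allFin n) (allFin n) (λ x → 𝟙 (P? x)) ⟩
  ∑ℤ (allFin n) (λ i → ∑ℤ (allFin n) (λ j → 𝟙 (P? (i , j))))
    ≡⟨ inv-∑ σ ⟩
  ℤ.+ inv σ ∎)
  where
  open ≡-Reasoning
  P? : Decidable (λ ((i , j) : Fin n × Fin n) → i Fin.< j × Vec.lookup σ j Fin.< Vec.lookup σ i)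
  P? (i , j) = (i Fin.<? j) ×-dec (Vec.lookup σ j Fin.<? Vec.lookup σ i)

-- Induction on the number of rows, with the first value `c` of the tuple as the column chosen in
-- the first row. The inversions of `c` with later values are the smaller entries of `S`, so their
-- sign is that of the position of `c` in `S`. Rows and columns are indexed by different types
-- because each step shortens the column list without renaming its entries.
leibniz : ∀ q (M : Fin k → Fin N → ℤ) {S : List (Fin N)} → AllPairs Fin._<_ S → length S ≡ k →
  ∑ℤ (tuples k S) (λ τ → 𝟙 (distinct? τ) * (q ℤ.^ inv τ * ∏ℤ (allFin k) (λ i → M i (Vec.lookup τ i)))) ≡
  minor q M (allFin k) S
leibniz {zero} q M {[]} inc len = refl
leibniz {suc k} {N} q M {S} inc len = begin
  ∑ℤ (tuples (suc k) S) weight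
    ≡⟨ ∑-cartesianProductWith _∷_ S (tuples k S) weight ⟩
  ∑ℤ S (λ c → ∑ℤ (tuples k S) (λ τ → weight (c ∷ τ)))
    ≡⟨ ∑-cong S (λ c → ∑-cong (tuples k S) (λ τ → split-distinct c τ)) ⟩
  ∑ℤ S (λ c → ∑ℤ (tuples k S) (λ τ → 𝟙 (VecAll.all? (λ y → ¬? (c Fin.≟ y)) τ) * weight′ c τ))
    ≡⟨ ∑-cong S (λ c → sym (∑-tuples-filter (λ y → ¬? (c Fin.≟ y)) S k (weight′ c))) ⟩
  ∑ℤ S (λ c → ∑ℤ (tuples k (filter (λ y → ¬? (c Fin.≟ y)) S)) (weight′ c))
    ≡⟨ ∑-cong S (λ c → cong (λ R → ∑ℤ (tuples k R) (weight′ c)) (remove≡ c)) ⟩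
  ∑ℤ S (λ c → ∑ℤ (tuples k (S ∖ (c ∷ []))) (weight′ c))
    ≡⟨ ∑-cong-∈ S inner ⟩
  ∑ℤ S (λ c → q ℤ.^ rank c S * (M zero c * minor q (λ i → M (suc i)) (allFin k) (S ∖ (c ∷ []))))
    ≡⟨ expand-rank q _ inc ⟨
  expand q (λ c ds → M zero c * minor q (λ i → M (suc i)) (allFin k) ds) S
    ≡⟨ expand-cong q (λ c ds → cong (M zero c *_) (trans
         (sym (minor-map q M suc id (allFin k) ds))
         (cong₂ (minor q M) (map-tabulate id suc) (map-id ds)))) S ⟩
  minor q M (allFin (suc k)) S
    ∎
  where
  open ≡-Reasoning
  weight : Vec (Fin N) (suc k) → ℤ
  weight τ = 𝟙 (distinct? τ) * (q ℤ.^ inv τ * ∏ℤ (allFin (suc k)) (λ i → M i (Vec.lookup τ i)))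
  rest : Vec (Fin N) k → ℤ
  rest τ = 𝟙 (distinct? τ) * (q ℤ.^ inv τ * ∏ℤ (allFin k) (λ i → M (suc i) (Vec.lookup τ i)))
  weight′ : Fin N → Vec (Fin N) k → ℤ
  weight′ c τ = q ℤ.^ rank c (Vec.toList τ) * (M zero c * rest τ)
  u : Unique S
  u = AllPairs.map Fin.<⇒≢ inc
  split-distinct : ∀ c τ → weight (c ∷ τ) ≡ 𝟙 (VecAll.all? (λ y → ¬? (c Fin.≟ y)) τ) * weight′ c τ
  split-distinct c τ = trans
    (cong₂ _*_
      (trans (𝟙-cong (distinct? (c ∷ τ)) (VecAll.all? (λ y → ¬? (c Fin.≟ y)) τ ×-dec distinct? τ)
               (λ { (p VecAllPairs.∷ d) → p , d }) (λ (p , d) → p VecAllPairs.∷ d))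
             (𝟙-× (VecAll.all? (λ y → ¬? (c Fin.≟ y)) τ) (distinct? τ)))
      (cong₂ _*_ (ℤ.^-distribˡ-+-* q (rank c (Vec.toList τ)) (inv τ)) (∏-allFin (λ i → M i (Vec.lookup (c ∷ τ) i)))))
    (regroup (𝟙 (VecAll.all? (λ y → ¬? (c Fin.≟ y)) τ)) (𝟙 (distinct? τ)) (q ℤ.^ rank c (Vec.toList τ)) (q ℤ.^ inv τ) (M zero c) _)
    where
    regroup : ∀ p d r i m x → (p * d) * ((r * i) * (m * x)) ≡ p * (r * (m * (d * (i * x))))
    regroup = solve-∀
  remove≡ : ∀ c → filter (λ y → ¬? (c Fin.≟ y)) S ≡ S ∖ (c ∷ [])
  remove≡ c = filter-≐ _ _ ((λ { c≢ (here refl) → c≢ refl }) , λ { ∉ refl → ∉ (here refl) }) S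
  inner : ∀ {c} → c ∈ S → ∑ℤ (tuples k (S ∖ (c ∷ []))) (weight′ c) ≡
          q ℤ.^ rank c S * (M zero c * minor q (λ i → M (suc i)) (allFin k) (S ∖ (c ∷ [])))
  inner {c} c∈S = begin
    ∑ℤ (tuples k (S ∖ (c ∷ []))) (weight′ c)
      ≡⟨ ∑-cong-∈ (tuples k (S ∖ (c ∷ []))) same-rank ⟩
    ∑ℤ (tuples k (S ∖ (c ∷ []))) (λ τ → q ℤ.^ rank c S * (M zero c * rest τ))
      ≡⟨ trans (∑-* (q ℤ.^ rank c S) (tuples k (S ∖ (c ∷ []))) _) (cong (q ℤ.^ rank c S *_) (∑-* (M zero c) (tuples k (S ∖ (c ∷ []))) rest)) ⟩
    q ℤ.^ rank c S * (M zero c * ∑ℤ (tuples k (S ∖ (c ∷ []))) rest)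
      ≡⟨ cong (λ x → q ℤ.^ rank c S * (M zero c * x)) (leibniz q (λ i → M (suc i)) (AllPairs-filter inc) len′) ⟩
    q ℤ.^ rank c S * (M zero c * minor q (λ i → M (suc i)) (allFin k) (S ∖ (c ∷ [])))
      ∎
    where
    AllPairs-filter = AllPairs.filter⁺ (λ x → ¬? (x ∈ᵥ? (c ∷ [])))
    S↭ : S ↭ c ∷ (S ∖ (c ∷ []))
    S↭ = ↭-extract u c∈S
    len′ : length (S ∖ (c ∷ [])) ≡ k
    len′ = ℕ.suc-injective (trans (sym (↭-length S↭)) len)
    rank-S : rank c S ≡ rank c (S ∖ (c ∷ []))
    rank-S = trans (↭-length (filter-↭ (Fin._<? c) S↭)) (cong length (filter-reject (Fin._<? c) (Fin.<-irrefl refl)))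
    same-rank : ∀ {τ} → τ ∈ tuples k (S ∖ (c ∷ [])) → weight′ c τ ≡ q ℤ.^ rank c S * (M zero c * rest τ)
    same-rank {τ} τ∈ = begin
      q ℤ.^ rank c (Vec.toList τ) * (M zero c * rest τ)
        ≡⟨ pull (q ℤ.^ rank c (Vec.toList τ)) (M zero c) (𝟙 (distinct? τ)) _ ⟩
      𝟙 (distinct? τ) * (q ℤ.^ rank c (Vec.toList τ) * (M zero c * (q ℤ.^ inv τ * _)))
        -- A tuple with distinct entries, as long as the list it is drawn from, is a permutation of
        -- that list. So the rank of `c` does not depend on `τ`.
        ≡⟨ 𝟙-*-cong (distinct? τ) (λ d → cong (λ r → q ℤ.^ r * _) (trans
             (↭-length (filter-↭ (Fin._<? c) (↭-full (∖-unique _ u) (toList-Unique d) (VecAll.toList⁺ (tuples-∈ τ∈))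
               (trans (Vec.length-toList τ) (sym len′)))))
             (sym rank-S))) ⟩
      𝟙 (distinct? τ) * (q ℤ.^ rank c S * (M zero c * (q ℤ.^ inv τ * _)))
        ≡⟨ pull (q ℤ.^ rank c S) (M zero c) (𝟙 (distinct? τ)) _ ⟨
      q ℤ.^ rank c S * (M zero c * rest τ)
        ∎
      where
      pull : ∀ r m d x → r * (m * (d * x)) ≡ d * (r * (m * x))
      pull = solve-∀

allFin-sorted : ∀ k → AllPairs Fin._<_ (allFin k)
allFin-sorted k = AllPairs.tabulate⁺-< id

∏-entries : Matrix n → Vec (Fin n) n → ℤ
∏-entries {n} M σ = ∏ℤ (allFin n) (λ i → M i (Vec.lookup σ i))

∑-permutations : ∀ q (M : Matrix n) →
  ∑ℤ (permutations n) (λ σ → q ℤ.^ inversions σ * ∏-entries M σ) ≡ minor q M (allFin n) (allFin n)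
∑-permutations {n} q M = trans
  (∑-filter distinct? (tuples n (allFin n)) (λ σ → q ℤ.^ inversions σ * ∏-entries M σ))
  (trans
    (∑-cong (tuples n (allFin n)) (λ σ → cong (λ i → 𝟙 (distinct? σ) * (q ℤ.^ i * ∏-entries M σ)) (inversions≡inv σ)))
    (leibniz q M (allFin-sorted n) (length-tabulate id)))

det≡minor : (M : Matrix n) → det M ≡ minor -1ℤ M (allFin n) (allFin n)
det≡minor = ∑-permutations -1ℤ

per≡minor : (M : Matrix n) → per M ≡ minor 1ℤ M (allFin n) (allFin n)
per≡minor {n} M = trans
  (∑-cong (permutations n) (λ σ → sym (trans
    (cong (_* ∏-entries M σ) (ℤ.^-zeroˡ (inversions σ))) (ℤ.*-identityˡ (∏-entries M σ)))))
  (∑-permutations 1ℤ M)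

det-principal : (M : Matrix n) (S : List (Fin n)) → det (principalSubmatrix M S) ≡ minor -1ℤ M S S
det-principal M S = trans (det≡minor (principalSubmatrix M S)) (trans
  (sym (minor-map -1ℤ M (lookup S) (lookup S) (allFin (length S)) (allFin (length S))))
  (cong₂ (minor -1ℤ M) lookups lookups))
  where
  lookups : map (lookup S) (allFin (length S)) ≡ S
  lookups = trans (map-tabulate id (lookup S)) (tabulate-lookup S)

-- Expansion along the cycles through a vertex

infix 4 _⊑_ _⊑?_

_⊑_ : List (Fin n) → List (Fin n) → Set
R ⊑ S = All (_∈ S) R

_⊑?_ : (R S : List (Fin n)) → Dec (R ⊑ S)
R ⊑? S = All.all? (_∈ᵥ? S) R

-- This replaces the varying range `S` by a fixed one, which matches the enumeration of all lists by
-- their heads.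
∑-members : {S : List (Fin n)} → Unique S → (g : Fin n → ℤ) → ∑ℤ S g ≡ ∑ℤ (allFin n) (λ w → 𝟙 (w ∈ᵥ? S) * g w)
∑-members {n} {[]}    []         g = sym (∑-zero (allFin n) (λ _ → refl))
∑-members {n} {c ∷ S} u@(_ ∷ uS) g = sym (begin
  ∑ℤ (allFin n) (λ w → 𝟙 (w ∈ᵥ? (c ∷ S)) * g w)
    ≡⟨ ∑-cong (allFin n) (λ w → trans (cong (_* g w) (split w)) (ℤ.*-distribʳ-+ (g w) (𝟙 (w Fin.≟ c)) (𝟙 (w ∈ᵥ? S)))) ⟩
  ∑ℤ (allFin n) (λ w → 𝟙 (w Fin.≟ c) * g w + 𝟙 (w ∈ᵥ? S) * g w)
    ≡⟨ ∑-+ (allFin n) (λ w → 𝟙 (w Fin.≟ c) * g w) (λ w → 𝟙 (w ∈ᵥ? S) * g w) ⟩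
  ∑ℤ (allFin n) (λ w → 𝟙 (w Fin.≟ c) * g w) + ∑ℤ (allFin n) (λ w → 𝟙 (w ∈ᵥ? S) * g w)
    ≡⟨ cong₂ _+_ (∑-single (Fin._≟ c) (allFin⁺ n) (∈-allFin c) refl (λ _ → id) g) (sym (∑-members uS g)) ⟩
  g c + ∑ℤ S g ∎)
  where
  open ≡-Reasoning
  split : ∀ w → 𝟙 (w ∈ᵥ? (c ∷ S)) ≡ 𝟙 (w Fin.≟ c) + 𝟙 (w ∈ᵥ? S)
  split w = go (w Fin.≟ c)
    where
    go : (d : Dec (w ≡ c)) → 𝟙 (w ∈ᵥ? (c ∷ S)) ≡ 𝟙 d + 𝟙 (w ∈ᵥ? S)
    go (yes refl) = trans (𝟙-yes (w ∈ᵥ? (w ∷ S)) (here refl))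
      (sym (cong (1ℤ +_) (𝟙-no (w ∈ᵥ? S) (Unique[x∷xs]⇒x∉xs u))))
    go (no w≢c) = trans (𝟙-cong (w ∈ᵥ? (c ∷ S)) (w ∈ᵥ? S)
      (λ { (here w≡c) → contradiction w≡c w≢c ; (there w∈S) → w∈S }) there) (sym (ℤ.+-identityˡ _))

-- At K = n this is the list of candidates from which 4kCycles is filtered.
listsUpTo : (n K : ℕ) → List (List (Fin n))
listsUpTo n K = concatMap (λ l → map Vec.toList (tuples l (allFin n))) (upTo (suc K))

∑-listsUpTo : ∀ K (f : List (Fin n) → ℤ) → ∑ℤ (listsUpTo n K) f ≡
              ∑ℤ (upTo (suc K)) (λ l → ∑ℤ (tuples l (allFin n)) (f ∘ Vec.toList))
∑-listsUpTo {n} K f = trans (∑-concatMap (λ l → map Vec.toList (tuples l (allFin n))) (upTo (suc K)) f)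
  (∑-cong (upTo (suc K)) (λ l → ∑-map Vec.toList (tuples l (allFin n)) f))

∑-upTo : ∀ K (g : ℕ → ℤ) → ∑ℤ (upTo (suc K)) g ≡ g 0 + ∑ℤ (upTo K) (g ∘ suc)
∑-upTo K g = cong (g 0 +_) (trans (cong (λ xs → ∑ℤ xs g) (sym (map-upTo suc K))) (∑-map suc (upTo K) g))

∑-listsUpTo-suc : ∀ K (f : List (Fin n) → ℤ) → ∑ℤ (listsUpTo n (suc K)) f ≡
                  f [] + ∑ℤ (allFin n) (λ w → ∑ℤ (listsUpTo n K) (f ∘ (w ∷_)))
∑-listsUpTo-suc {n} K f = begin
  ∑ℤ (listsUpTo n (suc K)) f
    ≡⟨ ∑-listsUpTo (suc K) f ⟩
  ∑ℤ (upTo (suc (suc K))) (λ l → ∑ℤ (tuples l (allFin n)) (f ∘ Vec.toList))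
    ≡⟨ ∑-upTo (suc K) (λ l → ∑ℤ (tuples l (allFin n)) (f ∘ Vec.toList)) ⟩
  f [] + 0ℤ + ∑ℤ (upTo (suc K)) (λ l → ∑ℤ (tuples (suc l) (allFin n)) (f ∘ Vec.toList))
    ≡⟨ cong₂ _+_ (ℤ.+-identityʳ (f [])) (∑-cong (upTo (suc K)) (λ l → ∑-cartesianProductWith _∷_ (allFin n) (tuples l (allFin n)) (f ∘ Vec.toList))) ⟩
  f [] + ∑ℤ (upTo (suc K)) (λ l → ∑ℤ (allFin n) (λ w → ∑ℤ (tuples l (allFin n)) (λ τ → f (w ∷ Vec.toList τ))))
    ≡⟨ cong (f [] +_) (∑-swap (upTo (suc K)) (allFin n) (λ l w → ∑ℤ (tuples l (allFin n)) (λ τ → f (w ∷ Vec.toList τ)))) ⟩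
  f [] + ∑ℤ (allFin n) (λ w → ∑ℤ (upTo (suc K)) (λ l → ∑ℤ (tuples l (allFin n)) (λ τ → f (w ∷ Vec.toList τ))))
    ≡⟨ cong (f [] +_) (∑-cong (allFin n) (λ w → sym (∑-listsUpTo K (f ∘ (w ∷_))))) ⟩
  f [] + ∑ℤ (allFin n) (λ w → ∑ℤ (listsUpTo n K) (f ∘ (w ∷_)))
    ∎
  where open ≡-Reasoning

-- These are the possible interiors of a path whose inner vertices lie in `S`.
Arrangement : List (Fin n) → List (Fin n) → Set
Arrangement S p = Unique p × p ⊑ S

arrangement? : (S p : List (Fin n)) → Dec (Arrangement S p)
arrangement? S p = unique? Fin._≟_ p ×-dec (p ⊑? S)

arrangement-∷⁺ : ∀ {S : List (Fin n)} {w p} → w ∈ S × Arrangement (S ∖ (w ∷ [])) p → Arrangement S (w ∷ p)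
arrangement-∷⁺ {S = S} {w} {p} (w∈S , u , p⊑) =
  All.map (λ x∈ w≡x → proj₂ (∈-∖⁻ S (w ∷ []) x∈) (here (sym w≡x))) p⊑ ∷ u ,
  w∈S ∷ All.map (proj₁ ∘ ∈-∖⁻ S (w ∷ [])) p⊑

arrangement-∷⁻ : ∀ {S : List (Fin n)} {w p} → Arrangement S (w ∷ p) → w ∈ S × Arrangement (S ∖ (w ∷ [])) p
arrangement-∷⁻ (w≢ ∷ u , w∈S ∷ p⊑) = w∈S , u , All.tabulate λ x∈p →
  ∈-∖⁺ (All.lookup p⊑ x∈p) (λ { (here refl) → All.lookup w≢ x∈p refl })

-1^even : ∀ {k} → 2 ∣ k → -1ℤ ℤ.^ k ≡ 1ℤ
-1^even (divides j refl) = trans (cong (-1ℤ ℤ.^_) (ℕ.*-comm j 2)) (trans (sym (ℤ.^-*-assoc -1ℤ 2 j)) (ℤ.^-zeroˡ j))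

module _ {n : ℕ} (G : Graph n) where
  open Graph G

  adj : Matrix n
  adj = adjacencyMatrix G

  walk? : ∀ u p v → Dec (Linked _~_ (u ∷ p ∷ʳ v))
  walk? u p v = Linked.linked? _~?_ (u ∷ p ∷ʳ v)

  -- Iterating `minor-step` spells out the interior `p` of a path from `u` to `v`: each inner vertex
  -- costs one factor `q`, and the vertices off the path contribute their own minor. Any bound `K`
  -- on the size of `S` serves, since no longer list is an arrangement in `S`; the induction is on
  -- that bound.
  minor-walks : ∀ {q} → q * q ≡ 1ℤ → ∀ K u v {S} → Unique S → length S ≤ K →
    minor q adj (u ∷ S) (v ∷ S) ≡
    ∑ℤ (listsUpTo n K) (λ p → 𝟙 (arrangement? S p) * (𝟙 (walk? u p v) * (q ℤ.^ length p * minor q adj (S ∖ p) (S ∖ p))))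
  minor-walks {q} q² K u v {S} uS len = trans (minor-step q² adj u v uS) (go K S uS len)
    where
    open ≡-Reasoning
    term : List (Fin n) → Fin n → List (Fin n) → ℤ
    term S u p = 𝟙 (arrangement? S p) * (𝟙 (walk? u p v) * (q ℤ.^ length p * minor q adj (S ∖ p) (S ∖ p)))
    term-[] : ∀ S → term S u [] ≡ adj u v * minor q adj S S
    term-[] S = trans (𝟙-*-yes (arrangement? S []) ([] , []) _) (cong₂ _*_
      (𝟙-cong (walk? u [] v) (u ~? v) (λ { (r ∷ [-]) → r }) (λ r → r ∷ [-]))
      (trans (ℤ.*-identityˡ _) (cong (λ R → minor q adj R R) (∖-[] S))))
    term-∷ : ∀ S w p → q * (𝟙 (w ∈ᵥ? S) * (adj u w * term (S ∖ (w ∷ [])) w p)) ≡ term S u (w ∷ p)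
    term-∷ S w p = trans
      (regroup q (𝟙 (w ∈ᵥ? S)) (adj u w) (𝟙 (arrangement? (S ∖ (w ∷ [])) p)) (𝟙 (walk? w p v)) (q ℤ.^ length p) _)
      (cong₂ _*_
        (trans (sym (𝟙-× (w ∈ᵥ? S) (arrangement? (S ∖ (w ∷ [])) p)))
               (𝟙-cong ((w ∈ᵥ? S) ×-dec arrangement? (S ∖ (w ∷ [])) p) (arrangement? S (w ∷ p)) arrangement-∷⁺ arrangement-∷⁻))
        (cong₂ _*_
          (trans (sym (𝟙-× (u ~? w) (walk? w p v)))
                 (𝟙-cong ((u ~? w) ×-dec walk? w p v) (walk? u (w ∷ p) v) (λ (r , rs) → r ∷ rs) (λ { (r ∷ rs) → r , rs })))
          (cong (λ R → q * q ℤ.^ length p * minor q adj R R) (∖-∷ S w p))))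
      where
      regroup : ∀ q s m r l x y → q * (s * (m * (r * (l * (x * y))))) ≡ (s * r) * ((m * l) * ((q * x) * y))
      regroup = solve-∀
    go : ∀ K S → Unique S → length S ≤ K →
         adj u v * minor q adj S S + q * ∑ℤ S (λ w → adj u w * minor q adj (w ∷ (S ∖ (w ∷ []))) (v ∷ (S ∖ (w ∷ [])))) ≡
         ∑ℤ (listsUpTo n K) (term S u)
    go zero [] uS len = cong₂ _+_ (sym (term-[] [])) (ℤ.*-zeroʳ q)
    go (suc K) S uS len = trans
      (cong₂ _+_ (sym (term-[] S)) (begin
        q * ∑ℤ S (λ w → adj u w * minor q adj (w ∷ (S ∖ (w ∷ []))) (v ∷ (S ∖ (w ∷ []))))
          ≡⟨ cong (q *_) (∑-cong-∈ S (λ {w} w∈S → cong (adj u w *_) (minor-walks q² K w v (∖-unique _ uS) (shorter w∈S)))) ⟩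
        q * ∑ℤ S (λ w → adj u w * ∑ℤ (listsUpTo n K) (term (S ∖ (w ∷ [])) w))
          ≡⟨ cong (q *_) (∑-members uS _) ⟩
        q * ∑ℤ (allFin n) (λ w → 𝟙 (w ∈ᵥ? S) * (adj u w * ∑ℤ (listsUpTo n K) (term (S ∖ (w ∷ [])) w)))
          ≡⟨ ∑-* q (allFin n) _ ⟨
        ∑ℤ (allFin n) (λ w → q * (𝟙 (w ∈ᵥ? S) * (adj u w * ∑ℤ (listsUpTo n K) (term (S ∖ (w ∷ [])) w))))
          ≡⟨ ∑-cong (allFin n) (λ w → pull w) ⟩
        ∑ℤ (allFin n) (λ w → ∑ℤ (listsUpTo n K) (λ p → term S u (w ∷ p)))
          ∎))
      (sym (∑-listsUpTo-suc K (term S u)))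
      where
      shorter : ∀ {w} → w ∈ S → length (S ∖ (w ∷ [])) ≤ K
      shorter w∈S = ℕ.≤-pred (subst (ℕ._≤ suc K) (length-∖ uS ([] ∷ []) (w∈S ∷ [])) len)
      pull : ∀ w → q * (𝟙 (w ∈ᵥ? S) * (adj u w * ∑ℤ (listsUpTo n K) (term (S ∖ (w ∷ [])) w))) ≡
                   ∑ℤ (listsUpTo n K) (λ p → term S u (w ∷ p))
      pull w = sym (trans
        (∑-cong (listsUpTo n K) (λ p → sym (term-∷ S w p)))
        (trans (∑-* q (listsUpTo n K) _) (cong (q *_)
          (trans (∑-* (𝟙 (w ∈ᵥ? S)) (listsUpTo n K) _) (cong (𝟙 (w ∈ᵥ? S) *_)
            (∑-* (adj u w) (listsUpTo n K) _))))))

  -- Colours alternate along a walk, so a closed walk has an even number of edges. Both parities are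
  -- proved together, because each step turns one into the other.
  closed-even : Bipartite G → ∀ {v p} → IsCycle G (v ∷ p) → 2 ∣ suc (length p)
  closed-even (colour , proper) {v} {p} (_ , linked) = proj₁ (parity v p v linked) refl
    where
    parity : ∀ u p v → Linked _~_ (u ∷ p ∷ʳ v) →
             (colour u ≡ colour v → 2 ∣ suc (length p)) × (colour u ≢ colour v → 2 ∣ length p)
    parity u []      v (u~v ∷ _) = (λ eq → contradiction eq (proper u~v)) , λ _ → 2 ∣0
    parity u (w ∷ p) v (u~w ∷ l) with parity w p v l
    ... | same , diff =
      (λ u≡v → ∣m∣n⇒∣m+n {2} {2} ∣-refl (diff (λ w≡v → proper u~w (trans u≡v (sym w≡v))))) ,
      -- There are only two colours: `w` and `v` both differ in colour from `u`, so they share one.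
      (λ u≢v → same (trans (¬-not (proper u~w ∘ sym)) (sym (¬-not (u≢v ∘ sym)))))

  -- The case `u = v` of `minor-walks`, with the conditions regrouped. A cyclic permutation of l
  -- points has sign (-1)^(l-1), and l - 1 is the length of `p`, which omits `v`.
  cycle-expansion : ∀ {q} → q * q ≡ 1ℤ → ∀ {v S} → Unique (v ∷ S) → length S ≤ n →
    minor q adj (v ∷ S) (v ∷ S) ≡
    ∑ℤ (listsUpTo n n) (λ p → 𝟙 (isCycle? G (v ∷ p)) * (𝟙 ((v ∷ p) ⊑? (v ∷ S)) *
      (q ℤ.^ length p * minor q adj ((v ∷ S) ∖ (v ∷ p)) ((v ∷ S) ∖ (v ∷ p)))))
  cycle-expansion {q} q² {v} {S} u@(_ ∷ uS) len = trans (minor-walks q² n v v uS len)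
    (∑-cong (listsUpTo n n) (λ p → trans (sym (ℤ.*-assoc (𝟙 (arrangement? S p)) _ _)) (trans
      (cong₂ _*_
        (trans (sym (𝟙-× (arrangement? S p) (walk? v p v))) (trans
          (𝟙-cong (arrangement? S p ×-dec walk? v p v) (isCycle? G (v ∷ p) ×-dec ((v ∷ p) ⊑? (v ∷ S))) to from)
          (𝟙-× (isCycle? G (v ∷ p)) ((v ∷ p) ⊑? (v ∷ S)))))
        (cong (λ R → q ℤ.^ length p * minor q adj R R) (rest p)))
      (ℤ.*-assoc (𝟙 (isCycle? G (v ∷ p))) _ _))))
    where
    v∉S : v ∉ S
    v∉S = Unique[x∷xs]⇒x∉xs u
    to : ∀ {p} → Arrangement S p × Linked _~_ (v ∷ p ∷ʳ v) → IsCycle G (v ∷ p) × (v ∷ p) ⊑ (v ∷ S)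
    to ((up , p⊑) , l) = (All.map (λ { x∈S refl → v∉S x∈S }) p⊑ ∷ up , l) , here refl ∷ All.map there p⊑
    from : ∀ {p} → IsCycle G (v ∷ p) × (v ∷ p) ⊑ (v ∷ S) → Arrangement S p × Linked _~_ (v ∷ p ∷ʳ v)
    from ((v≢ ∷ up , l) , _ ∷ p⊑) = (up , All.tabulate (λ x∈p → strip (All.lookup p⊑ x∈p) (All.lookup v≢ x∈p))) , l
      where
      strip : ∀ {x} → x ∈ v ∷ S → v ≢ x → x ∈ S
      strip (here refl) v≢x = contradiction refl v≢x
      strip (there x∈S) _   = x∈S
    rest : ∀ p → S ∖ p ≡ (v ∷ S) ∖ (v ∷ p)
    rest p = trans (cong (_∖ p) (sym (∷-∖-head u))) (∖-∷ (v ∷ S) v p)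

  -- Fixing the starting vertex `v` makes every directed cycle through `v` occur once. An undirected
  -- cycle of length at least 3 therefore occurs twice, and an edge, read as a 2-cycle, once.
  cycleSum : Fin n → List (Fin n) → (List (Fin n) → ℤ) → ℤ
  cycleSum v T h = ∑ℤ (listsUpTo n n) (λ p → 𝟙 (isCycle? G (v ∷ p)) * (𝟙 ((v ∷ p) ⊑? T) * h (T ∖ (v ∷ p))))

  perOn detOn : List (Fin n) → ℤ
  perOn S = minor 1ℤ adj S S
  detOn S = minor -1ℤ adj S S

  perOn-cycles : ∀ {v S} → Unique (v ∷ S) → length S ≤ n → perOn (v ∷ S) ≡ cycleSum v (v ∷ S) perOn
  perOn-cycles {v} {S} u len = trans (cycle-expansion refl u len)
    (∑-cong (listsUpTo n n) (λ p → cong (λ x → 𝟙 (isCycle? G (v ∷ p)) * (𝟙 ((v ∷ p) ⊑? (v ∷ S)) * x))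
      (trans (cong (_* perOn ((v ∷ S) ∖ (v ∷ p))) (ℤ.^-zeroˡ (length p))) (ℤ.*-identityˡ (perOn ((v ∷ S) ∖ (v ∷ p)))))))

  detOn-cycles : Bipartite G → ∀ {v S} → Unique (v ∷ S) → length S ≤ n → detOn (v ∷ S) ≡ - cycleSum v (v ∷ S) detOn
  detOn-cycles bip {v} {S} u len = trans (cycle-expansion refl u len) (trans
    (∑-cong (listsUpTo n n) (λ p → trans
      (𝟙-*-cong (isCycle? G (v ∷ p)) (λ cyc → cong (λ x → 𝟙 ((v ∷ p) ⊑? (v ∷ S)) * (x * minorAt p)) (sign p cyc)))
      (pull (𝟙 (isCycle? G (v ∷ p))) (𝟙 ((v ∷ p) ⊑? (v ∷ S))) (minorAt p))))
    (trans (∑-* -1ℤ (listsUpTo n n) (λ p → 𝟙 (isCycle? G (v ∷ p)) * (𝟙 ((v ∷ p) ⊑? (v ∷ S)) * minorAt p)))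
      (ℤ.-1*i≡-i (cycleSum v (v ∷ S) detOn))))
    where
    minorAt : List (Fin n) → ℤ
    minorAt p = detOn ((v ∷ S) ∖ (v ∷ p))
    -- The list `p` is one shorter than the cycle, whose length is even.
    sign : ∀ p → IsCycle G (v ∷ p) → -1ℤ ℤ.^ length p ≡ -1ℤ
    sign p cyc = trans (sym (ℤ.neg-involutive _)) (cong -_ (trans (sym (ℤ.-1*i≡-i _)) (-1^even (closed-even bip cyc))))
    pull : ∀ i j x → i * (j * (-1ℤ * x)) ≡ -1ℤ * (i * (j * x))
    pull = solve-∀

-- Sums over tuples of disjoint 4k-cycles

infixl 6 _∖∖_
_∖∖_ : List (Fin n) → Vec (List (Fin n)) k → List (Fin n)
S ∖∖ T = filter (λ v → ¬? (VecAny.any? (v ∈ᵥ?_) T)) S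

∖∖-∷ : ∀ (S R : List (Fin n)) (T : Vec (List (Fin n)) k) → S ∖ R ∖∖ T ≡ S ∖∖ (R ∷ T)
∖∖-∷ S R T = filter-filter _ _ _
  (λ { ∉T ∉R (VecAny.here ∈R) → ∉R ∈R ; ∉T ∉R (VecAny.there ∈T) → ∉T ∈T })
  (λ ∉ → ∉ ∘ VecAny.there , ∉ ∘ VecAny.here) S

pairwiseDisjoint? : (T : Vec (List (Fin n)) k) → Dec (VecAllPairs.AllPairs Disjoint T)
pairwiseDisjoint? = VecAllPairs.allPairs? (disjoint? Fin._≟_)

⊑-∖⁺ : ∀ {S R X : List (Fin n)} → X ⊑ S → Disjoint R X → X ⊑ S ∖ R
⊑-∖⁺ X⊑S R#X = All.tabulate λ x∈X → ∈-∖⁺ (All.lookup X⊑S x∈X) (λ x∈R → R#X (x∈R , x∈X))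

⊑-∖⁻ : ∀ {S R X : List (Fin n)} → X ⊑ S ∖ R → X ⊑ S × Disjoint R X
⊑-∖⁻ {S = S} {R} X⊑ = All.map (proj₁ ∘ ∈-∖⁻ S R) X⊑ , λ (x∈R , x∈X) → proj₂ (∈-∖⁻ S R (All.lookup X⊑ x∈X)) x∈R

module _ {n : ℕ} (G : Graph n) where
  open Graph G

  -- This is f_z of the overview. Deleting each chosen cycle before choosing the next builds
  -- disjointness into containment, and makes induction on the first component possible.
  tupleSum : ℕ → List (Fin n) → ℤ
  tupleSum zero    S = detOn G S
  tupleSum (suc z) S = ∑ℤ (4kCycles G) (λ R → 𝟙 (R ⊑? S) * tupleSum z (S ∖ R))

  -- A tuple with head `R` is disjoint and lies in `S` exactly when `R` lies in `S` and the tail is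
  -- disjoint and lies in what `R` leaves of `S`.
  tupleSum-∑ : ∀ z S → tupleSum z S ≡ ∑ℤ (tuples z (4kCycles G)) (λ T →
    𝟙 (pairwiseDisjoint? T) * (𝟙 (VecAll.all? (_⊑? S) T) * detOn G (S ∖∖ T)))
  tupleSum-∑ zero    S = sym (trans (unit (detOn G (S ∖∖ [])))
    (cong (λ U → detOn G U) {S ∖∖ []} {S} (filter-all (λ v → ¬? (VecAny.any? (v ∈ᵥ?_) [])) (All.tabulate λ _ ()))))
    where
    unit : ∀ x → 1ℤ * (1ℤ * x) + 0ℤ ≡ x
    unit = solve-∀
  tupleSum-∑ (suc z) S = sym (trans
    (∑-cartesianProductWith _∷_ (4kCycles G) (tuples z (4kCycles G)) (term S))
    (∑-cong (4kCycles G) (λ R → trans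
      (∑-cong (tuples z (4kCycles G)) (split R))
      (trans (∑-* (𝟙 (R ⊑? S)) (tuples z (4kCycles G)) (term (S ∖ R)))
             (cong (𝟙 (R ⊑? S) *_) (sym (tupleSum-∑ z (S ∖ R))))))))
    where
    term : ∀ {z} (S : List (Fin n)) → Vec (List (Fin n)) z → ℤ
    term S T = 𝟙 (pairwiseDisjoint? T) * (𝟙 (VecAll.all? (_⊑? S) T) * detOn G (S ∖∖ T))
    split : ∀ R (T : Vec (List (Fin n)) z) → term S (R ∷ T) ≡ 𝟙 (R ⊑? S) * term (S ∖ R) T
    split R T = begin
      𝟙 (pairwiseDisjoint? (R ∷ T)) * (𝟙 (VecAll.all? (_⊑? S) (R ∷ T)) * detOn G (S ∖∖ (R ∷ T)))
        ≡⟨ sym (ℤ.*-assoc (𝟙 (pairwiseDisjoint? (R ∷ T))) _ _) ⟩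
      𝟙 (pairwiseDisjoint? (R ∷ T)) * 𝟙 (VecAll.all? (_⊑? S) (R ∷ T)) * detOn G (S ∖∖ (R ∷ T))
        ≡⟨ cong₂ _*_ (sym (𝟙-× (pairwiseDisjoint? (R ∷ T)) (VecAll.all? (_⊑? S) (R ∷ T)))) (cong (detOn G) (sym (∖∖-∷ S R T))) ⟩
      𝟙 (pairwiseDisjoint? (R ∷ T) ×-dec VecAll.all? (_⊑? S) (R ∷ T)) * detOn G (S ∖ R ∖∖ T)
        ≡⟨ cong (_* detOn G (S ∖ R ∖∖ T)) (𝟙-cong (pairwiseDisjoint? (R ∷ T) ×-dec VecAll.all? (_⊑? S) (R ∷ T))
             ((R ⊑? S) ×-dec (pairwiseDisjoint? T ×-dec VecAll.all? (_⊑? (S ∖ R)) T)) to from) ⟩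
      𝟙 ((R ⊑? S) ×-dec (pairwiseDisjoint? T ×-dec VecAll.all? (_⊑? (S ∖ R)) T)) * detOn G (S ∖ R ∖∖ T)
        ≡⟨ cong (_* detOn G (S ∖ R ∖∖ T)) (trans (𝟙-× (R ⊑? S) (pairwiseDisjoint? T ×-dec VecAll.all? (_⊑? (S ∖ R)) T)) (cong (𝟙 (R ⊑? S) *_) (𝟙-× (pairwiseDisjoint? T) (VecAll.all? (_⊑? (S ∖ R)) T)))) ⟩
      𝟙 (R ⊑? S) * (𝟙 (pairwiseDisjoint? T) * 𝟙 (VecAll.all? (_⊑? (S ∖ R)) T)) * detOn G (S ∖ R ∖∖ T)
        ≡⟨ regroup (𝟙 (R ⊑? S)) (𝟙 (pairwiseDisjoint? T)) (𝟙 (VecAll.all? (_⊑? (S ∖ R)) T)) (detOn G (S ∖ R ∖∖ T)) ⟩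
      𝟙 (R ⊑? S) * term (S ∖ R) T
        ∎
      where
      open ≡-Reasoning
      regroup : ∀ x y z w → x * (y * z) * w ≡ x * (y * (z * w))
      regroup = solve-∀
      to : VecAllPairs.AllPairs Disjoint (R ∷ T) × VecAll.All (_⊑ S) (R ∷ T) →
           R ⊑ S × VecAllPairs.AllPairs Disjoint T × VecAll.All (_⊑ (S ∖ R)) T
      to (R# VecAllPairs.∷ d , R⊑ VecAll.∷ T⊑) =
        R⊑ , d , VecAll.map (λ (X⊑ , R#X) → ⊑-∖⁺ X⊑ R#X) (VecAll.zip (T⊑ , R#))
      from : R ⊑ S × VecAllPairs.AllPairs Disjoint T × VecAll.All (_⊑ (S ∖ R)) T →
             VecAllPairs.AllPairs Disjoint (R ∷ T) × VecAll.All (_⊑ S) (R ∷ T)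
      from (R⊑ , d , T⊑) = VecAll.map (λ {X} → proj₂ ∘ ⊑-∖⁻ {S = S} {R} {X}) T⊑ VecAllPairs.∷ d , R⊑ VecAll.∷ VecAll.map (λ {X} → proj₁ ∘ ⊑-∖⁻ {S = S} {R} {X}) T⊑

  disjointTuples-∑ : ∀ z → ∑ℤ (disjointTuples G z) (det-∖ G) ≡ tupleSum z (allFin n)
  disjointTuples-∑ z = trans (∑-filter pairwiseDisjoint? (tuples z (4kCycles G)) (det-∖ G)) (trans
    (∑-cong (tuples z (4kCycles G)) (λ T → cong (𝟙 (pairwiseDisjoint? T) *_) (trans
      (det-principal (adj G) (allFin n ∖∖ T))
      (sym (𝟙-*-yes (VecAll.all? (_⊑? allFin n) T) (VecAll.universal (λ R → All.universal ∈-allFin R) T) (detOn G (allFin n ∖∖ T)))))))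
    (sym (tupleSum-∑ z (allFin n))))

  4kCycles-sound : ∀ {R} → R ∈ 4kCycles G → Is4kCycle G R
  4kCycles-sound R∈ = proj₂ (∈-filter⁻ (is4kCycle? G) {xs = listsUpTo n n} (∈-deduplicate⁻ sameSubgraph? (filter (is4kCycle? G) (listsUpTo n n)) R∈))

  -- Every term would need `suc m` disjoint 4k-cycles. This allows a series that stops at `m` to be
  -- continued by one term without changing its value.
  tupleSum-vanishes : ∀ {m} → AtMostDisjoint4kCycles G m → ∀ S → tupleSum (suc m) S ≡ 0ℤ
  tupleSum-vanishes {m} atMost S = trans (tupleSum-∑ (suc m) S)
    (∑-zero (tuples (suc m) (4kCycles G)) (λ {T} T∈ → 𝟙-*-no (pairwiseDisjoint? T)
      (λ d → ℕ.<-irrefl refl (atMost T (VecAll.map 4kCycles-sound (tuples-∈ T∈)) d))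
      (𝟙 (VecAll.all? (_⊑? S) T) * detOn G (S ∖∖ T))))

  throughSum : ℕ → Fin n → List (Fin n) → ℤ
  throughSum z v T = ∑ℤ (4kCycles G) (λ R → 𝟙 (v ∈ᵥ? R) * (𝟙 (R ⊑? T) * tupleSum z (T ∖ R)))

  -- Removing a cycle that avoids v commutes with removing a set containing v.
  removal-exchange : (v : Fin n) (T : List (Fin n)) (xs : List A) (X : A → List (Fin n)) (w : A → ℤ) →
    (∀ x → w x ≡ 0ℤ ⊎ v ∈ X x) → (h : List (Fin n) → ℤ) →
    ∑ℤ (4kCycles G) (λ R → 𝟙 (¬? (v ∈ᵥ? R)) * (𝟙 (R ⊑? T) *
      ∑ℤ xs (λ x → w x * (𝟙 (X x ⊑? (T ∖ R)) * h (T ∖ R ∖ X x))))) ≡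
    ∑ℤ xs (λ x → w x * (𝟙 (X x ⊑? T) * ∑ℤ (4kCycles G) (λ R → 𝟙 (R ⊑? (T ∖ X x)) * h (T ∖ X x ∖ R))))
  removal-exchange v T xs X w supp h = begin
    ∑ℤ Rs (λ R → 𝟙 (¬? (v ∈ᵥ? R)) * (𝟙 (R ⊑? T) * ∑ℤ xs (λ x → w x * (𝟙 (X x ⊑? (T ∖ R)) * h (T ∖ R ∖ X x)))))
      ≡⟨ ∑-cong Rs (λ R → sym (trans (∑-* (𝟙 (¬? (v ∈ᵥ? R))) xs (λ x → 𝟙 (R ⊑? T) * (w x * (𝟙 (X x ⊑? (T ∖ R)) * h (T ∖ R ∖ X x)))))
           (cong (𝟙 (¬? (v ∈ᵥ? R)) *_) (∑-* (𝟙 (R ⊑? T)) xs (λ x → w x * (𝟙 (X x ⊑? (T ∖ R)) * h (T ∖ R ∖ X x))))))) ⟩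
    ∑ℤ Rs (λ R → ∑ℤ xs (λ x → 𝟙 (¬? (v ∈ᵥ? R)) * (𝟙 (R ⊑? T) * (w x * (𝟙 (X x ⊑? (T ∖ R)) * h (T ∖ R ∖ X x))))))
      ≡⟨ ∑-swap Rs xs (λ R x → 𝟙 (¬? (v ∈ᵥ? R)) * (𝟙 (R ⊑? T) * (w x * (𝟙 (X x ⊑? (T ∖ R)) * h (T ∖ R ∖ X x))))) ⟩
    ∑ℤ xs (λ x → ∑ℤ Rs (λ R → 𝟙 (¬? (v ∈ᵥ? R)) * (𝟙 (R ⊑? T) * (w x * (𝟙 (X x ⊑? (T ∖ R)) * h (T ∖ R ∖ X x))))))
      ≡⟨ ∑-cong xs (λ x → ∑-cong Rs (λ R → exchange x R (supp x))) ⟩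
    ∑ℤ xs (λ x → ∑ℤ Rs (λ R → w x * (𝟙 (X x ⊑? T) * (𝟙 (R ⊑? (T ∖ X x)) * h (T ∖ X x ∖ R)))))
      ≡⟨ ∑-cong xs (λ x → trans (∑-* (w x) Rs (λ R → 𝟙 (X x ⊑? T) * (𝟙 (R ⊑? (T ∖ X x)) * h (T ∖ X x ∖ R))))
           (cong (w x *_) (∑-* (𝟙 (X x ⊑? T)) Rs (λ R → 𝟙 (R ⊑? (T ∖ X x)) * h (T ∖ X x ∖ R))))) ⟩
    ∑ℤ xs (λ x → w x * (𝟙 (X x ⊑? T) * ∑ℤ Rs (λ R → 𝟙 (R ⊑? (T ∖ X x)) * h (T ∖ X x ∖ R))))
      ∎
    where
    open ≡-Reasoning
    Rs : List (List (Fin n))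
    Rs = 4kCycles G
    exchange : ∀ x R → w x ≡ 0ℤ ⊎ v ∈ X x →
      𝟙 (¬? (v ∈ᵥ? R)) * (𝟙 (R ⊑? T) * (w x * (𝟙 (X x ⊑? (T ∖ R)) * h (T ∖ R ∖ X x)))) ≡
      w x * (𝟙 (X x ⊑? T) * (𝟙 (R ⊑? (T ∖ X x)) * h (T ∖ X x ∖ R)))
    -- The first alternative covers weights that are themselves the indicator of `v` lying in the
    -- set: where `v` is missing, both sides are zero.
    exchange x R (inj₁ w≡0) = trans
      (trans (cong (λ y → 𝟙 (¬? (v ∈ᵥ? R)) * (𝟙 (R ⊑? T) * (y * (𝟙 (X x ⊑? (T ∖ R)) * h (T ∖ R ∖ X x))))) w≡0)
             (trans (cong (𝟙 (¬? (v ∈ᵥ? R)) *_) (ℤ.*-zeroʳ (𝟙 (R ⊑? T)))) (ℤ.*-zeroʳ (𝟙 (¬? (v ∈ᵥ? R))))))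
      (sym (cong (_* (𝟙 (X x ⊑? T) * (𝟙 (R ⊑? (T ∖ X x)) * h (T ∖ X x ∖ R)))) w≡0))
    exchange x R (inj₂ v∈X) = begin
      𝟙 (¬? (v ∈ᵥ? R)) * (𝟙 (R ⊑? T) * (w x * (𝟙 (X x ⊑? (T ∖ R)) * h (T ∖ R ∖ X x))))
        ≡⟨ pull (𝟙 (¬? (v ∈ᵥ? R))) (𝟙 (R ⊑? T)) (w x) (𝟙 (X x ⊑? (T ∖ R))) _ ⟩
      w x * ((𝟙 (¬? (v ∈ᵥ? R)) * (𝟙 (R ⊑? T) * 𝟙 (X x ⊑? (T ∖ R)))) * h (T ∖ R ∖ X x))
        ≡⟨ cong₂ (λ y R′ → w x * (y * h R′)) indicators (∖-comm T R (X x)) ⟩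
      w x * ((𝟙 (X x ⊑? T) * 𝟙 (R ⊑? (T ∖ X x))) * h (T ∖ X x ∖ R))
        ≡⟨ cong (w x *_) (ℤ.*-assoc (𝟙 (X x ⊑? T)) _ _) ⟩
      w x * (𝟙 (X x ⊑? T) * (𝟙 (R ⊑? (T ∖ X x)) * h (T ∖ X x ∖ R)))
        ∎
      where
      pull : ∀ i j w k y → i * (j * (w * (k * y))) ≡ w * ((i * (j * k)) * y)
      pull = solve-∀
      indicators : 𝟙 (¬? (v ∈ᵥ? R)) * (𝟙 (R ⊑? T) * 𝟙 (X x ⊑? (T ∖ R))) ≡ 𝟙 (X x ⊑? T) * 𝟙 (R ⊑? (T ∖ X x))
      indicators = trans (cong (𝟙 (¬? (v ∈ᵥ? R)) *_) (sym (𝟙-× (R ⊑? T) (X x ⊑? (T ∖ R))))) (trans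
        (sym (𝟙-× (¬? (v ∈ᵥ? R)) ((R ⊑? T) ×-dec (X x ⊑? (T ∖ R))))) (trans
        (𝟙-cong (¬? (v ∈ᵥ? R) ×-dec ((R ⊑? T) ×-dec (X x ⊑? (T ∖ R)))) ((X x ⊑? T) ×-dec (R ⊑? (T ∖ X x)))
          -- Both conditions say that `R` and `X x` are disjoint subsets of `T`. As `v` lies in
          -- `X x`, disjointness already forces `v` out of `R`, so that factor is absorbed.
          (λ (_ , R⊑ , X⊑) → let X⊑T , R#X = ⊑-∖⁻ X⊑ in X⊑T , ⊑-∖⁺ R⊑ (λ (x∈ , r∈) → R#X (r∈ , x∈)))
          (λ (X⊑ , R⊑) → let R⊑T , X#R = ⊑-∖⁻ R⊑ in
            (λ v∈R → X#R (v∈X , v∈R)) , R⊑T , ⊑-∖⁺ X⊑ (λ (r∈ , x∈) → X#R (x∈ , r∈))))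
        (𝟙-× (X x ⊑? T) (R ⊑? (T ∖ X x)))))

  -- The cycle through v may stand at any of the z positions of a tuple.
  chosenThrough : ℕ → Fin n → List (Fin n) → ℤ
  chosenThrough zero    v T = 0ℤ
  chosenThrough (suc z) v T = ℤ.+ suc z * throughSum z v T

  -- Induction on `z`, by the first component `R` of the tuple. If `R` contains `v`, it contributes
  -- one `throughSum`. Otherwise `v` survives the deletion of `R` and the induction hypothesis
  -- applies there; `removal-exchange` then lets `R` be deleted after the cycle through `v`, where
  -- it again becomes the first component of a tuple. The later positions give `z` copies of
  -- `throughSum`, so there are `suc z` in all.
  tupleSum-cycles : Bipartite G → ∀ z {v S} → Unique (v ∷ S) → length S ≤ n →
    tupleSum z (v ∷ S) ≡ chosenThrough z v (v ∷ S) + - cycleSum G v (v ∷ S) (tupleSum z)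
  tupleSum-cycles bip zero    u len = trans (detOn-cycles G bip u len) (sym (ℤ.+-identityˡ _))
  tupleSum-cycles bip (suc z) {v} {S} u@(_ ∷ uS) len = begin
    ∑ℤ Rs (λ R → 𝟙 (R ⊑? T) * tupleSum z (T ∖ R))
      ≡⟨ ∑-cong Rs (λ R → split (v ∈ᵥ? R) (𝟙 (R ⊑? T)) (IH R)) ⟩
    ∑ℤ Rs (λ R → through R + (missed R + -1ℤ * walked R))
      ≡⟨ trans (∑-+ Rs through (λ R → missed R + -1ℤ * walked R))
           (cong (throughSum z v T +_) (trans (∑-+ Rs missed (λ R → -1ℤ * walked R)) (cong (∑ℤ Rs missed +_) (∑-* -1ℤ Rs walked)))) ⟩
    throughSum z v T + (∑ℤ Rs missed + -1ℤ * ∑ℤ Rs walked)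
      ≡⟨ cong₂ (λ x y → throughSum z v T + (x + -1ℤ * y)) (missed≡ z) walked≡ ⟩
    throughSum z v T + (ℤ.+ z * throughSum z v T + -1ℤ * cycleSum G v T (tupleSum (suc z)))
      ≡⟨ collect (ℤ.+ z) (throughSum z v T) (cycleSum G v T (tupleSum (suc z))) ⟩
    (1ℤ + ℤ.+ z) * throughSum z v T + - cycleSum G v T (tupleSum (suc z))
      ∎
    where
    open ≡-Reasoning
    Rs : List (List (Fin n))
    Rs = 4kCycles G
    T : List (Fin n)
    T = v ∷ S
    through missed walked : List (Fin n) → ℤ
    through R = 𝟙 (v ∈ᵥ? R) * (𝟙 (R ⊑? T) * tupleSum z (T ∖ R))
    missed R  = 𝟙 (¬? (v ∈ᵥ? R)) * (𝟙 (R ⊑? T) * chosenThrough z v (T ∖ R))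
    walked R  = 𝟙 (¬? (v ∈ᵥ? R)) * (𝟙 (R ⊑? T) * cycleSum G v (T ∖ R) (tupleSum z))
    IH : ∀ R → v ∉ R → tupleSum z (T ∖ R) ≡ chosenThrough z v (T ∖ R) + - cycleSum G v (T ∖ R) (tupleSum z)
    IH R v∉R = subst (λ U → tupleSum z U ≡ chosenThrough z v U + - cycleSum G v U (tupleSum z))
      (sym (∖-∷-∉ S v∉R))
      (tupleSum-cycles bip z (subst Unique (∖-∷-∉ S v∉R) (∖-unique R u))
        (ℕ.≤-trans (length-filter (λ x → ¬? (x ∈ᵥ? R)) S) len))
    split : ∀ {P : Set} (d : Dec P) i {t m w} → (¬ P → t ≡ m + - w) →
            i * t ≡ 𝟙 d * (i * t) + (𝟙 (¬? d) * (i * m) + -1ℤ * (𝟙 (¬? d) * (i * w)))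
    split (yes p) i {t} {m} {w} _ = here≡ i t
      where
      here≡ : ∀ i t → i * t ≡ 1ℤ * (i * t) + 0ℤ
      here≡ = solve-∀
    split (no ¬p) i {t} {m} {w} eq = trans (cong (i *_) (eq ¬p)) (there≡ i m w)
      where
      there≡ : ∀ i m w → i * (m + - w) ≡ 0ℤ + (1ℤ * (i * m) + -1ℤ * (1ℤ * (i * w)))
      there≡ = solve-∀
    missed≡ : ∀ z → ∑ℤ Rs (λ R → 𝟙 (¬? (v ∈ᵥ? R)) * (𝟙 (R ⊑? T) * chosenThrough z v (T ∖ R))) ≡ ℤ.+ z * throughSum z v T
    missed≡ zero    = ∑-zero Rs (λ {R} _ → trans (cong (𝟙 (¬? (v ∈ᵥ? R)) *_) (ℤ.*-zeroʳ (𝟙 (R ⊑? T)))) (ℤ.*-zeroʳ (𝟙 (¬? (v ∈ᵥ? R)))))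
    missed≡ (suc z) = trans
      (∑-cong Rs (λ R → pull (𝟙 (¬? (v ∈ᵥ? R))) (𝟙 (R ⊑? T)) (ℤ.+ suc z) (throughSum z v (T ∖ R))))
      (trans (∑-* (ℤ.+ suc z) Rs (λ R → 𝟙 (¬? (v ∈ᵥ? R)) * (𝟙 (R ⊑? T) * throughSum z v (T ∖ R)))) (cong (ℤ.+ suc z *_)
        (removal-exchange v T Rs id (λ R → 𝟙 (v ∈ᵥ? R)) supp (tupleSum z))))
      where
      pull : ∀ i j k x → i * (j * (k * x)) ≡ k * (i * (j * x))
      pull = solve-∀
      supp : ∀ R → 𝟙 (v ∈ᵥ? R) ≡ 0ℤ ⊎ v ∈ R
      supp R with v ∈ᵥ? R
      ... | yes v∈R = inj₂ v∈R
      ... | no _    = inj₁ refl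
    walked≡ : ∑ℤ Rs walked ≡ cycleSum G v T (tupleSum (suc z))
    walked≡ = removal-exchange v T (listsUpTo n n) (v ∷_) (λ p → 𝟙 (isCycle? G (v ∷ p))) (λ p → inj₂ (here refl)) (tupleSum z)
    collect : ∀ z b c → b + (z * b + -1ℤ * c) ≡ (1ℤ + z) * b + - c
    collect = solve-∀

-- Cycles as subgraphs and as vertex sequences

Unique-resp-↭ : {xs ys : List A} → xs ↭ ys → Unique xs → Unique ys
Unique-resp-↭ p = ↭ₛ.Unique-resp-↭ (setoid _) (↭⇒↭ₛ p)

-- The edges of a cycle are the steps of its vertex list with the first vertex repeated at the end.
-- In this form they can be cut at a vertex and reversed.
steps : List A → List (A × A)
steps []           = []
steps (x ∷ [])     = []
steps (x ∷ y ∷ xs) = (x , y) ∷ steps (y ∷ xs)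

zip-steps : ∀ (x : A) xs v → zip (x ∷ xs) (xs ∷ʳ v) ≡ steps (x ∷ xs ∷ʳ v)
zip-steps x []       v = refl
zip-steps x (y ∷ xs) v = cong ((x , y) ∷_) (zip-steps y xs v)

steps-++ : ∀ (xs : List A) v ys → steps (xs ++ v ∷ ys) ≡ steps (xs ∷ʳ v) ++ steps (v ∷ ys)
steps-++ []           v ys = refl
steps-++ (x ∷ [])     v ys = refl
steps-++ (x ∷ y ∷ xs) v ys = cong ((x , y) ∷_) (steps-++ (y ∷ xs) v ys)

steps-reverse : (xs : List A) → steps (reverse xs) ↭ map ×.swap (steps xs)
steps-reverse []           = ↭-refl
steps-reverse (x ∷ [])     = ↭-refl
steps-reverse (x ∷ y ∷ xs) = ↭-trans
  (↭.↭-reflexive (begin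
    steps (reverse (x ∷ y ∷ xs))           ≡⟨ cong steps (unfold-reverse x (y ∷ xs)) ⟩
    steps (reverse (y ∷ xs) ∷ʳ x)          ≡⟨ cong (λ zs → steps (zs ∷ʳ x)) (unfold-reverse y xs) ⟩
    steps ((reverse xs ∷ʳ y) ∷ʳ x)         ≡⟨ cong steps (++-assoc (reverse xs) (y ∷ []) (x ∷ [])) ⟩
    steps (reverse xs ++ y ∷ x ∷ [])       ≡⟨ steps-++ (reverse xs) y (x ∷ []) ⟩
    steps (reverse xs ∷ʳ y) ∷ʳ (y , x)     ≡⟨ cong (λ zs → steps zs ∷ʳ (y , x)) (unfold-reverse y xs) ⟨
    steps (reverse (y ∷ xs)) ∷ʳ (y , x)    ∎))
  (↭-trans (↭-sym (∷↭∷ʳ (y , x) _)) (prep (y , x) (steps-reverse (y ∷ xs))))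
  where open ≡-Reasoning

Linked⇒All-steps : {R : Rel A b} {xs : List A} → Linked R xs → All (uncurry R) (steps xs)
Linked⇒All-steps Linked.[]  = []
Linked⇒All-steps [-]        = []
Linked⇒All-steps (r ∷ rs)   = r ∷ Linked⇒All-steps rs

All-steps⇒Linked : {R : Rel A b} (xs : List A) → All (uncurry R) (steps xs) → Linked R xs
All-steps⇒Linked []           _        = Linked.[]
All-steps⇒Linked (x ∷ [])     _        = [-]
All-steps⇒Linked (x ∷ y ∷ xs) (r ∷ rs) = r ∷ All-steps⇒Linked (y ∷ xs) rs

∈-zipˡ : ∀ {xs : List A} {ys : List B} {x y} → (x , y) ∈ zip xs ys → x ∈ xs
∈-zipˡ {xs = x ∷ xs} {y ∷ ys} (here refl) = here refl
∈-zipˡ {xs = x ∷ xs} {y ∷ ys} (there p)   = there (∈-zipˡ p)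

zip-functional : ∀ {xs : List A} {ys : List B} → Unique xs → ∀ {x y z} →
                 (x , y) ∈ zip xs ys → (x , z) ∈ zip xs ys → y ≡ z
zip-functional {xs = x ∷ xs} {y ∷ ys} _        (here refl) (here refl) = refl
zip-functional {xs = x ∷ xs} {y ∷ ys} (x≢ ∷ _) (here refl) (there z∈)  = contradiction refl (All.lookup x≢ (∈-zipˡ z∈))
zip-functional {xs = x ∷ xs} {y ∷ ys} (x≢ ∷ _) (there y∈)  (here refl) = contradiction refl (All.lookup x≢ (∈-zipˡ y∈))
zip-functional {xs = x ∷ xs} {y ∷ ys} (_ ∷ u)  (there y∈)  (there z∈)  = zip-functional u y∈ z∈

∈-zip-swap : ∀ (xs : List A) (ys : List B) {x y} → (x , y) ∈ zip xs ys → (y , x) ∈ zip ys xs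
∈-zip-swap (x ∷ xs) (y ∷ ys) (here refl) = here refl
∈-zip-swap (x ∷ xs) (y ∷ ys) (there p)   = there (∈-zip-swap xs ys p)

edges-functional : ∀ {v : Fin n} {p} → Unique (v ∷ p) → ∀ {x y z} →
                   (x , y) ∈ edges (v ∷ p) → (x , z) ∈ edges (v ∷ p) → y ≡ z
edges-functional u = zip-functional u

edges-injective : ∀ {v : Fin n} {p} → Unique (v ∷ p) → ∀ {x y z} →
                  (x , z) ∈ edges (v ∷ p) → (y , z) ∈ edges (v ∷ p) → x ≡ y
edges-injective {v = v} {p} u x∈ y∈ = zip-functional (Unique-resp-↭ (∷↭∷ʳ v p) u)
  (∈-zip-swap (v ∷ p) (p ∷ʳ v) x∈) (∈-zip-swap (v ∷ p) (p ∷ʳ v) y∈)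

-- Stronger than `SameSubgraph`: orientation and multiplicities are kept, so distinctness, adjacency
-- and length carry over from one list to the other.
SameCycle : List (Fin n) → List (Fin n) → Set
SameCycle R S = R ↭ S × edges R ↭ edges S

rotate : ∀ {v : Fin n} {R} → v ∈ R → ∃[ p ] SameCycle (v ∷ p) R
rotate {v = v} v∈R with ∈-∃++ v∈R
... | []     , ys , refl = ys , ↭-refl , ↭-refl
... | x ∷ xs , ys , refl = ys ++ x ∷ xs , ++-comm (v ∷ ys) (x ∷ xs) , ↭-trans
  -- The vertices `v` and `x` cut the closed walk into two arcs; starting at `v` instead of `x` only
  -- exchanges the arcs.
  (↭.↭-reflexive (begin
    edges (v ∷ ys ++ x ∷ xs)                     ≡⟨ zip-steps v (ys ++ x ∷ xs) v ⟩
    steps (v ∷ (ys ++ x ∷ xs) ∷ʳ v)              ≡⟨ cong (λ zs → steps (v ∷ zs)) (++-assoc ys (x ∷ xs) (v ∷ [])) ⟩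
    steps ((v ∷ ys) ++ x ∷ xs ∷ʳ v)              ≡⟨ steps-++ (v ∷ ys) x (xs ∷ʳ v) ⟩
    steps (v ∷ ys ∷ʳ x) ++ steps (x ∷ xs ∷ʳ v)   ∎))
  (↭-trans (++-comm (steps (v ∷ ys ∷ʳ x)) (steps (x ∷ xs ∷ʳ v)))
  (↭.↭-reflexive (begin
    steps (x ∷ xs ∷ʳ v) ++ steps (v ∷ ys ∷ʳ x)   ≡⟨ steps-++ (x ∷ xs) v (ys ∷ʳ x) ⟨
    steps ((x ∷ xs) ++ v ∷ ys ∷ʳ x)              ≡⟨ cong (λ zs → steps (x ∷ zs)) (++-assoc xs (v ∷ ys) (x ∷ [])) ⟨
    steps (x ∷ (xs ++ v ∷ ys) ∷ʳ x)              ≡⟨ zip-steps x (xs ++ v ∷ ys) x ⟨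
    edges (x ∷ xs ++ v ∷ ys)                     ∎)))
  where open ≡-Reasoning

edges-reverse : ∀ (v : Fin n) p → edges (v ∷ reverse p) ↭ map ×.swap (edges (v ∷ p))
edges-reverse v p = ↭-trans (↭.↭-reflexive (begin
    edges (v ∷ reverse p)          ≡⟨ zip-steps v (reverse p) v ⟩
    steps (v ∷ reverse p ∷ʳ v)     ≡⟨ cong (λ zs → steps (zs ∷ʳ v)) (reverse-++ p (v ∷ [])) ⟨
    steps (reverse (p ∷ʳ v) ∷ʳ v)  ≡⟨ cong steps (unfold-reverse v (p ∷ʳ v)) ⟨
    steps (reverse (v ∷ p ∷ʳ v))   ∎))
  (↭-trans (steps-reverse (v ∷ p ∷ʳ v)) (↭.↭-reflexive (cong (map ×.swap) (sym (zip-steps v p v)))))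
  where open ≡-Reasoning

SameSubgraph-refl : ∀ (R : List (Fin n)) → SameSubgraph R R
SameSubgraph-refl R = (λ v → mk⇔ id id) , λ u v → mk⇔ id id

SameSubgraph-sym : ∀ {R S : List (Fin n)} → SameSubgraph R S → SameSubgraph S R
SameSubgraph-sym (V , E) = (λ v → mk⇔ (Equivalence.from (V v)) (Equivalence.to (V v))) ,
  λ u v → mk⇔ (Equivalence.from (E u v)) (Equivalence.to (E u v))

SameSubgraph-trans : ∀ {R S T : List (Fin n)} → SameSubgraph R S → SameSubgraph S T → SameSubgraph R T
SameSubgraph-trans (V , E) (W , F) =
  (λ v → mk⇔ (Equivalence.to (W v) ∘ Equivalence.to (V v)) (Equivalence.from (V v) ∘ Equivalence.from (W v))) ,
  λ u v → mk⇔ (Equivalence.to (F u v) ∘ Equivalence.to (E u v)) (Equivalence.from (E u v) ∘ Equivalence.from (F u v))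

SameCycle⇒SameSubgraph : ∀ {R S : List (Fin n)} → SameCycle R S → SameSubgraph R S
SameCycle⇒SameSubgraph (V , E) =
  (λ v → mk⇔ (∈-resp-↭ V) (∈-resp-↭ (↭-sym V))) ,
  λ u v → mk⇔ (Sum.map (∈-resp-↭ E) (∈-resp-↭ E)) (Sum.map (∈-resp-↭ (↭-sym E)) (∈-resp-↭ (↭-sym E)))

∈-edges-reverse : ∀ (v : Fin n) p {x y} → (x , y) ∈ edges (v ∷ p) → (y , x) ∈ edges (v ∷ reverse p)
∈-edges-reverse v p e = ∈-resp-↭ (↭-sym (edges-reverse v p)) (∈-map⁺ ×.swap e)

∈-edges-reverse⁻ : ∀ (v : Fin n) p {x y} → (x , y) ∈ edges (v ∷ reverse p) → (y , x) ∈ edges (v ∷ p)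
∈-edges-reverse⁻ v p {x} {y} e = subst (λ q → (y , x) ∈ edges (v ∷ q)) (reverse-involutive p) (∈-edges-reverse v (reverse p) e)

reverse-SameSubgraph : ∀ (v : Fin n) p → SameSubgraph (v ∷ reverse p) (v ∷ p)
reverse-SameSubgraph v p =
  (λ u → mk⇔ (∈-resp-↭ (prep v (↭-reverse p))) (∈-resp-↭ (↭-sym (prep v (↭-reverse p))))) ,
  λ x y → mk⇔
    (λ { (inj₁ e) → inj₂ (∈-edges-reverse⁻ v p e) ; (inj₂ e) → inj₁ (∈-edges-reverse⁻ v p e) })
    (λ { (inj₁ e) → inj₂ (∈-edges-reverse v p e) ; (inj₂ e) → inj₁ (∈-edges-reverse v p e) })

-- Two closed walks from v along a functional relation agree until the first return to v.
walk-determined : ∀ {E : List (A × A)} {v : A} → (∀ {x y z} → (x , y) ∈ E → (x , z) ∈ E → y ≡ z) →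
  ∀ x (s t : List A) → All (v ≢_) s → All (v ≢_) t →
  All (_∈ E) (steps (x ∷ s ∷ʳ v)) → All (_∈ E) (steps (x ∷ t ∷ʳ v)) → s ≡ t
walk-determined fun x []      []      _ _ _ _ = refl
walk-determined fun x []      (z ∷ t) _ (v≢z ∷ _) (e ∷ _) (e′ ∷ _) = contradiction (fun e e′) v≢z
walk-determined fun x (y ∷ s) []      (v≢y ∷ _) _ (e ∷ _) (e′ ∷ _) = contradiction (fun e′ e) v≢y
walk-determined fun x (y ∷ s) (z ∷ t) (_ ∷ v∉s) (_ ∷ v∉t) (e ∷ es) (e′ ∷ es′) with refl ← fun e e′ =
  cong (y ∷_) (walk-determined fun y s t v∉s v∉t es es′)

-- A walk on an undirected cycle that never turns back keeps its initial direction.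
same-direction : ∀ {E : List (A × A)} {v : A} → (∀ {x y z} → (x , z) ∈ E → (y , z) ∈ E → x ≡ y) →
  ∀ x y s → Unique (x ∷ y ∷ s) → All (v ≢_) (y ∷ s) → (s ≡ [] → v ≢ x) → (x , y) ∈ E →
  All (λ (a , b) → (a , b) ∈ E ⊎ (b , a) ∈ E) (steps (y ∷ s ∷ʳ v)) → All (_∈ E) (steps (y ∷ s ∷ʳ v))
same-direction inj x y [] u v∉ turn xy (inj₁ e ∷ []) = e ∷ []
-- A step against the direction would give `y` two predecessors. On the last step the second
-- predecessor is `v`, which distinctness does not separate from `x`: on a 2-cycle the two coincide,
-- and `turn` rules this out.
same-direction inj x y [] u v∉ turn xy (inj₂ e ∷ []) = contradiction (inj e xy) (turn refl)
same-direction inj x y (z ∷ s) ((_ ∷ x≢z ∷ _) ∷ u) (_ ∷ v∉) turn xy (inj₂ e ∷ es) = contradiction (sym (inj e xy)) x≢z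
same-direction inj x y (z ∷ s) (_ ∷ u) (v≢y ∷ v∉) turn xy (inj₁ e ∷ es) =
  e ∷ same-direction inj y z s u v∉ (λ _ → v≢y) e es

All-∈ : (xs : List A) → All (_∈ xs) xs
All-∈ xs = All.tabulate id

-- Sharing the directed first edge fixes the direction of the whole walk by `same-direction`, after
-- which every vertex has only one possible successor. The condition on `p` excludes the 2-cycle,
-- whose walk does turn back.
same-start : ∀ {v w : Fin n} {p r} → Unique (v ∷ w ∷ p) → Unique (v ∷ r) → SameSubgraph (v ∷ w ∷ p) (v ∷ r) →
             p ≢ [] → (v , w) ∈ edges (v ∷ r) → w ∷ p ≡ r
same-start {v = v} {w} {p} {r} up@(v∉p ∷ _) ur@(v∉r ∷ _) (_ , E) p≢[] vw =
  walk-determined (edges-functional ur) v (w ∷ p) r v∉p v∉r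
    (vw ∷ same-direction (edges-injective ur) v w p up v∉p (λ p≡[] → contradiction p≡[] p≢[]) vw along)
    (subst (All (_∈ edges (v ∷ r))) (zip-steps v r v) (All-∈ (edges (v ∷ r))))
  where
  along : All (λ (a , b) → (a , b) ∈ edges (v ∷ r) ⊎ (b , a) ∈ edges (v ∷ r)) (steps (w ∷ p ∷ʳ v))
  along = All.map (λ {(a , b)} e → Equivalence.to (E a b) (inj₁ (there e)))
    (subst (λ es → All (_∈ es) (steps (w ∷ p ∷ʳ v))) (sym (zip-steps w p v)) (All-∈ _))

-- The first edge of one cycle lies on the other in one of the two directions; in the second case,
-- reversing the other cycle reduces to the first.
two-directions : ∀ {v : Fin n} {p r} → Unique (v ∷ p) → Unique (v ∷ r) → SameSubgraph (v ∷ p) (v ∷ r) →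
                 2 ≤ length p → p ≡ r ⊎ p ≡ reverse r
two-directions {v = v} {w ∷ []} up ur same (s≤s ())
two-directions {v = v} {w ∷ x ∷ p} {r} up ur same@(_ , E) _ with Equivalence.to (E v w) (inj₁ (here refl))
... | inj₁ vw = inj₁ (same-start up ur same (λ ()) vw)
... | inj₂ wv = inj₂ (same-start up (Unique-resp-↭ (↭-sym (prep v (↭-reverse r))) ur)
                  (SameSubgraph-trans same (SameSubgraph-sym (reverse-SameSubgraph v r))) (λ ()) (∈-edges-reverse v r wv))

-- Otherwise the first entry would equal the last. Hence the two traversals of a 4k-cycle are
-- different lists.
≢-reverse : ∀ {p : List A} → Unique p → 2 ≤ length p → p ≢ reverse p
≢-reverse {p = w ∷ []}    u (s≤s ()) eq
≢-reverse {p = w ∷ x ∷ p} (w≢ ∷ _) _ eq = go (initLast (x ∷ p)) w≢ (λ ()) eq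
  where
  go : ∀ {q} → InitLast q → All (w ≢_) q → q ≢ [] → w ∷ q ≢ reverse (w ∷ q)
  go []        w≢ q≢[] eq = q≢[] refl
  go (t ∷ʳ′ z) w≢ q≢[] eq = All.lookup w≢ (∈-++⁺ʳ t (here refl))
    (∷-injectiveˡ (trans eq (trans (unfold-reverse w (t ∷ʳ z)) (cong (_∷ʳ w) (reverse-++ t (z ∷ []))))))

-- Enumeration of cycles and choice of representatives

length-Unique : {R : List (Fin n)} → Unique R → length R ≤ n
length-Unique {n} {R} u = subst (length R ≤_) (length-tabulate id) (length-≤ (allFin⁺ n) u (All.universal ∈-allFin R))

∈-tuples : ∀ {xs : List A} (p : List A) → All (_∈ xs) p → Vec.fromList p ∈ tuples (length p) xs
∈-tuples []      []        = here refl
∈-tuples (x ∷ p) (x∈ ∷ p⊆) = ∈-cartesianProductWith⁺ _∷_ x∈ (∈-tuples p p⊆)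

∈-listsUpTo : ∀ {K} {p : List (Fin n)} → length p ≤ K → p ∈ listsUpTo n K
∈-listsUpTo {n} {K} {p} len = ∈-concatMap⁺ (λ l → map Vec.toList (tuples l (allFin n)))
  (lose (∈-upTo⁺ (s≤s len))
    (subst (_∈ map Vec.toList (tuples (length p) (allFin n))) (Vec.toList∘fromList p)
      (∈-map⁺ Vec.toList (∈-tuples p (All.universal ∈-allFin p)))))

tuples-Unique : ∀ k {xs : List A} → Unique xs → Unique (tuples k xs)
tuples-Unique zero    u = [] ∷ []
tuples-Unique (suc k) u = Unique.cartesianProductWith⁺ _∷_ (λ { refl → refl , refl }) u (tuples-Unique k u)

toList-injective : ∀ {τ ρ : Vec A k} → Vec.toList τ ≡ Vec.toList ρ → τ ≡ ρ
toList-injective {τ = τ} {ρ} eq = trans (sym (Vec.cast-is-id refl τ)) (Vec.toList-injective refl τ ρ eq)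

listsUpTo-Unique : ∀ n K → Unique (listsUpTo n K)
listsUpTo-Unique n K = Unique.concat⁺
  (All.map⁺ (All.universal (λ l → Unique.map⁺ toList-injective (tuples-Unique l (allFin⁺ n))) (upTo (suc K))))
  (AllPairs.map⁺ (AllPairs.map disjoint (Unique.upTo⁺ (suc K))))
  where
  length-∈ : ∀ {l p} → p ∈ map Vec.toList (tuples l (allFin n)) → length p ≡ l
  length-∈ p∈ with τ , _ , refl ← ∈-map⁻ Vec.toList p∈ = Vec.length-toList τ
  disjoint : ∀ {k l} → k ≢ l → Disjoint (map Vec.toList (tuples k (allFin n))) (map Vec.toList (tuples l (allFin n)))
  disjoint k≢l (p∈k , p∈l) = k≢l (trans (sym (length-∈ p∈k)) (length-∈ p∈l))

module _ {R : Rel A b} (R? : ∀ x y → Dec (R x y)) where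

  deduplicate-distinct : ∀ xs → AllPairs (λ x y → ¬ R x y) (deduplicate R? xs)
  deduplicate-distinct []       = []
  deduplicate-distinct (x ∷ xs) = All.all-filter (λ y → ¬? (R? x y)) (deduplicate R? xs) ∷
    AllPairs.filter⁺ (λ y → ¬? (R? x y)) (deduplicate-distinct xs)

AllPairs-lookup : {R : Rel A b} → (∀ {x y} → R x y → R y x) → ∀ {xs} → AllPairs (λ x y → ¬ R x y) xs →
                  ∀ {x y} → x ∈ xs → y ∈ xs → R x y → x ≡ y
AllPairs-lookup R-sym (_ ∷ _)  (here refl) (here refl) r = refl
AllPairs-lookup R-sym (¬r ∷ _) (here refl) (there y∈)  r = contradiction r (All.lookup ¬r y∈)
AllPairs-lookup R-sym (¬r ∷ _) (there x∈)  (here refl) r = contradiction (R-sym r) (All.lookup ¬r x∈)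
AllPairs-lookup R-sym (_ ∷ ¬r) (there x∈)  (there y∈)  r = AllPairs-lookup R-sym ¬r x∈ y∈ r

module _ {n : ℕ} (G : Graph n) where
  open Graph G

  IsCycle⇒Unique : ∀ {R} → IsCycle G R → Unique R
  IsCycle⇒Unique {_ ∷ _} (u , _) = u

  IsCycle⇒edges : ∀ {R} → IsCycle G R → All (uncurry _~_) (edges R)
  IsCycle⇒edges {v ∷ p} (_ , l) = subst (All (uncurry _~_)) (sym (zip-steps v p v)) (Linked⇒All-steps l)

  edges⇒IsCycle : ∀ {v p} → Unique (v ∷ p) → All (uncurry _~_) (edges (v ∷ p)) → IsCycle G (v ∷ p)
  edges⇒IsCycle {v} {p} u es = u , All-steps⇒Linked (v ∷ p ∷ʳ v) (subst (All (uncurry _~_)) (zip-steps v p v) es)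

  4kCycle-resp : ∀ {v p R} → SameCycle (v ∷ p) R → Is4kCycle G R → Is4kCycle G (v ∷ p)
  4kCycle-resp (V , E) (cyc , 4∣) =
    edges⇒IsCycle (Unique-resp-↭ (↭-sym V) (IsCycle⇒Unique cyc)) (All-resp-↭ (↭-sym E) (IsCycle⇒edges cyc)) ,
    subst (4 ∣_) (sym (↭-length V)) 4∣

  4kCycle-reverse : ∀ {v p} → Is4kCycle G (v ∷ p) → Is4kCycle G (v ∷ reverse p)
  4kCycle-reverse {v} {p} (cyc , 4∣) =
    edges⇒IsCycle (Unique-resp-↭ (↭-sym (prep v (↭-reverse p))) (IsCycle⇒Unique cyc))
      (All-resp-↭ (↭-sym (edges-reverse v p)) (All.map⁺ (All.map ~-sym (IsCycle⇒edges cyc)))) ,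
    subst (4 ∣_) (cong suc (sym (length-reverse p))) 4∣

  4kCycle-long : ∀ {v p} → Is4kCycle G (v ∷ p) → 2 ≤ length p
  4kCycle-long (_ , 4∣) = ℕ.≤-trans (ℕ.n≤1+n 2) (ℕ.≤-pred (∣⇒≤ 4∣))

  ∈-candidates : ∀ {R} → Is4kCycle G R → R ∈ filter (is4kCycle? G) (listsUpTo n n)
  ∈-candidates {R} 4k@(cyc , _) = ∈-filter⁺ (is4kCycle? G) (∈-listsUpTo (length-Unique (IsCycle⇒Unique cyc))) 4k

  4kCycles-distinct : AllPairs (λ R S → ¬ SameSubgraph R S) (4kCycles G)
  4kCycles-distinct = deduplicate-distinct sameSubgraph? (filter (is4kCycle? G) (listsUpTo n n))

  representative : ∀ {R} → Is4kCycle G R → ∃[ S ] S ∈ 4kCycles G × SameSubgraph S R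
  representative {R} 4k = find (Any.deduplicate⁺ sameSubgraph? (λ y≈x x≈R → SameSubgraph-trans y≈x x≈R)
    (lose (∈-candidates 4k) (SameSubgraph-refl R)))

  -- Deduplication keeps exactly one vertex sequence per subgraph, so a single term survives, and
  -- `g` takes the same value there as at `C`.
  ∑-representative : (g : List (Fin n) → ℤ) → (∀ {R S} → SameSubgraph R S → g R ≡ g S) → ∀ {C} → Is4kCycle G C →
    ∑ℤ (4kCycles G) (λ R → 𝟙 (sameSubgraph? R C) * g R) ≡ g C
  ∑-representative g resp {C} 4k with S , S∈ , S≈C ← representative 4k = trans
    (∑-single (λ R → sameSubgraph? R C)
      (AllPairs.map (λ ¬same → λ { refl → ¬same (SameSubgraph-refl _) }) 4kCycles-distinct)
      S∈ S≈C
      (λ R∈ R≈C → AllPairs-lookup SameSubgraph-sym 4kCycles-distinct R∈ S∈ (SameSubgraph-trans R≈C (SameSubgraph-sym S≈C)))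
      g)
    (resp S≈C)

  -- Each undirected 4k-cycle through v is traversed from v in exactly two directions.
  ∑-traversals : (g : List (Fin n) → ℤ) → (∀ {R S} → SameSubgraph R S → g R ≡ g S) → ∀ v →
    ∑ℤ (listsUpTo n n) (λ p → 𝟙 (is4kCycle? G (v ∷ p)) * g (v ∷ p)) ≡
    ℤ.+ 2 * ∑ℤ (4kCycles G) (λ R → 𝟙 (v ∈ᵥ? R) * g R)
  ∑-traversals g resp v = begin
    ∑ℤ U (λ p → 𝟙 (is4kCycle? G (v ∷ p)) * g (v ∷ p))
      -- Each traversal is written as a sum over its one representative. Exchanging the sums leaves,
      -- for each representative, the number of its traversals from `v`.
      ≡⟨ ∑-cong U (λ p → 𝟙-*-cong (is4kCycle? G (v ∷ p)) (λ 4k → sym (∑-representative g resp 4k))) ⟩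
    ∑ℤ U (λ p → 𝟙 (is4kCycle? G (v ∷ p)) * ∑ℤ Rs (λ R → 𝟙 (sameSubgraph? R (v ∷ p)) * g R))
      ≡⟨ ∑-cong U (λ p → trans (sym (∑-* (𝟙 (is4kCycle? G (v ∷ p))) Rs (λ R → 𝟙 (sameSubgraph? R (v ∷ p)) * g R)))
           (∑-cong Rs (λ R → combine p R))) ⟩
    ∑ℤ U (λ p → ∑ℤ Rs (λ R → 𝟙 (traverses? R p) * g R))
      ≡⟨ ∑-swap U Rs (λ p R → 𝟙 (traverses? R p) * g R) ⟩
    ∑ℤ Rs (λ R → ∑ℤ U (λ p → 𝟙 (traverses? R p) * g R))
      ≡⟨ ∑-cong-∈ Rs (λ {R} R∈ → count R (4kCycles-sound G R∈) (v ∈ᵥ? R)) ⟩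
    ∑ℤ Rs (λ R → ℤ.+ 2 * (𝟙 (v ∈ᵥ? R) * g R))
      ≡⟨ ∑-* (ℤ.+ 2) Rs (λ R → 𝟙 (v ∈ᵥ? R) * g R) ⟩
    ℤ.+ 2 * ∑ℤ Rs (λ R → 𝟙 (v ∈ᵥ? R) * g R)
      ∎
    where
    open ≡-Reasoning
    U Rs : List (List (Fin n))
    U = listsUpTo n n
    Rs = 4kCycles G
    Traverses : List (Fin n) → List (Fin n) → Set
    Traverses R p = Is4kCycle G (v ∷ p) × SameSubgraph R (v ∷ p)
    traverses? : ∀ R p → Dec (Traverses R p)
    traverses? R p = is4kCycle? G (v ∷ p) ×-dec sameSubgraph? R (v ∷ p)
    combine : ∀ p R → 𝟙 (is4kCycle? G (v ∷ p)) * (𝟙 (sameSubgraph? R (v ∷ p)) * g R) ≡ 𝟙 (traverses? R p) * g R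
    combine p R = trans (sym (ℤ.*-assoc (𝟙 (is4kCycle? G (v ∷ p))) (𝟙 (sameSubgraph? R (v ∷ p))) (g R)))
      (cong (_* g R) (sym (𝟙-× (is4kCycle? G (v ∷ p)) (sameSubgraph? R (v ∷ p)))))
    p∈U : ∀ {p} → Is4kCycle G (v ∷ p) → p ∈ U
    p∈U (cyc , _) = ∈-listsUpTo (ℕ.<⇒≤ (length-Unique (IsCycle⇒Unique cyc)))
    count : ∀ R → Is4kCycle G R → (d : Dec (v ∈ R)) → ∑ℤ U (λ p → 𝟙 (traverses? R p) * g R) ≡ ℤ.+ 2 * (𝟙 d * g R)
    count R 4k (no v∉R) = ∑-zero U (λ {p} _ → 𝟙-*-no (traverses? R p)
      (λ (_ , V , _) → v∉R (Equivalence.from (V v) (here refl))) (g R))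
    count R 4k (yes v∈R) with p₀ , same ← rotate v∈R = trans
      (∑-double (traverses? R) (listsUpTo-Unique n n)
        (p∈U 4k₀) (4k₀ , R≈) (p∈U 4k₁) (4k₁ , SameSubgraph-trans R≈ (SameSubgraph-sym (reverse-SameSubgraph v p₀)))
        (≢-reverse (AllPairs-tail u₀) (4kCycle-long 4k₀))
        (λ {p} _ (4kp , R≈p) → two-directions (IsCycle⇒Unique (proj₁ 4kp)) u₀
          (SameSubgraph-trans (SameSubgraph-sym R≈p) R≈) (4kCycle-long 4kp))
        (λ _ → g R))
      (twice (g R))
      where
      4k₀ : Is4kCycle G (v ∷ p₀)
      4k₀ = 4kCycle-resp same 4k
      4k₁ : Is4kCycle G (v ∷ reverse p₀)
      4k₁ = 4kCycle-reverse 4k₀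
      u₀ : Unique (v ∷ p₀)
      u₀ = IsCycle⇒Unique (proj₁ 4k₀)
      R≈ : SameSubgraph R (v ∷ p₀)
      R≈ = SameSubgraph-sym (SameCycle⇒SameSubgraph same)
      AllPairs-tail : ∀ {x} {xs : List (Fin n)} → Unique (x ∷ xs) → Unique xs
      AllPairs-tail (_ ∷ u) = u
      twice : ∀ x → x + x ≡ ℤ.+ 2 * (1ℤ * x)
      twice = solve-∀

  throughSum-traversals : ∀ z v T →
    ∑ℤ (listsUpTo n n) (λ p → 𝟙 (is4kCycle? G (v ∷ p)) * (𝟙 ((v ∷ p) ⊑? T) * tupleSum G z (T ∖ (v ∷ p)))) ≡
    ℤ.+ 2 * throughSum G z v T
  throughSum-traversals z v T = ∑-traversals (λ R → 𝟙 (R ⊑? T) * tupleSum G z (T ∖ R)) respects v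
    where
    respects : ∀ {R S} → SameSubgraph R S → 𝟙 (R ⊑? T) * tupleSum G z (T ∖ R) ≡ 𝟙 (S ⊑? T) * tupleSum G z (T ∖ S)
    respects {R} {S} (V , _) = cong₂ _*_
      (𝟙-cong (R ⊑? T) (S ⊑? T)
        (λ R⊑ → All.tabulate (λ x∈S → All.lookup R⊑ (Equivalence.from (V _) x∈S)))
        (λ S⊑ → All.tabulate (λ x∈R → All.lookup S⊑ (Equivalence.to (V _) x∈R))))
      (cong (tupleSum G z) (filter-≐ (λ x → ¬? (x ∈ᵥ? R)) (λ x → ¬? (x ∈ᵥ? S))
        ((λ x∉R x∈S → x∉R (Equivalence.from (V _) x∈S)) , λ x∉S x∈R → x∉S (Equivalence.to (V _) x∈R)) T))

-- The weights 4ᶻ/z!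

fromℤ-+ : ∀ i j → fromℤ (i + j) ≡ fromℤ i ℚ.+ fromℤ j
fromℤ-+ i j = ℚ.toℚᵘ-injective (begin-equality
  ℚ.toℚᵘ (fromℤ (i + j))                   ≃⟨ ℚ.toℚᵘ-fromℚᵘ (mkℚᵘ (i + j) 0) ⟩
  mkℚᵘ (i + j) 0                           ≃⟨ *≡* (rescale i j) ⟩
  mkℚᵘ i 0 ℚᵘ.+ mkℚᵘ j 0                   ≃⟨ ℚᵘ.+-cong (ℚ.toℚᵘ-fromℚᵘ (mkℚᵘ i 0)) (ℚ.toℚᵘ-fromℚᵘ (mkℚᵘ j 0)) ⟨
  ℚ.toℚᵘ (fromℤ i) ℚᵘ.+ ℚ.toℚᵘ (fromℤ j)   ≃⟨ ℚ.toℚᵘ-homo-+ (fromℤ i) (fromℤ j) ⟨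
  ℚ.toℚᵘ (fromℤ i ℚ.+ fromℤ j)             ∎)
  where
  open ℚᵘ.≤-Reasoning
  rescale : ∀ i j → (i + j) * 1ℤ ≡ (i * 1ℤ + j * 1ℤ) * 1ℤ
  rescale = solve-∀

fromℤ-*-/ : ∀ k i j d e .{{_ : ℕ.NonZero d}} .{{_ : ℕ.NonZero e}} →
            k * i * ℤ.+ e ≡ j * ℤ.+ d → fromℤ k ℚ.* (i ℚ./ d) ≡ j ℚ./ e
fromℤ-*-/ k i j (suc d) (suc e) eq = ℚ.toℚᵘ-injective (begin-equality
  ℚ.toℚᵘ (fromℤ k ℚ.* (i ℚ./ suc d))             ≃⟨ ℚ.toℚᵘ-homo-* (fromℤ k) (i ℚ./ suc d) ⟩
  ℚ.toℚᵘ (fromℤ k) ℚᵘ.* ℚ.toℚᵘ (i ℚ./ suc d)     ≃⟨ ℚᵘ.*-cong (ℚ.toℚᵘ-fromℚᵘ (mkℚᵘ k 0)) (ℚ.toℚᵘ-fromℚᵘ (mkℚᵘ i d)) ⟩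
  mkℚᵘ k 0 ℚᵘ.* mkℚᵘ i d                         ≃⟨ *≡* (trans eq (cong (λ d → j * ℤ.+ suc d) (sym (ℕ.+-identityʳ d)))) ⟩
  mkℚᵘ j e                                       ≃⟨ ℚ.toℚᵘ-fromℚᵘ (mkℚᵘ j e) ⟨
  ℚ.toℚᵘ (j ℚ./ suc e)                           ∎)
  where open ℚᵘ.≤-Reasoning

fromℤ-* : ∀ i j → fromℤ (i * j) ≡ fromℤ i ℚ.* fromℤ j
fromℤ-* i j = sym (fromℤ-*-/ i j (i * j) 1 1 refl)

-- The factorial absorbs the `suc z` positions at which the cycle through the chosen vertex can
-- stand, and one factor 4 is released.
weight-suc : ∀ z → fromℤ (ℤ.+ suc z) ℚ.* 4^ suc z /! ≡ fromℤ (ℤ.+ 4) ℚ.* 4^ z /!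
weight-suc z = trans
  (fromℤ-*-/ (ℤ.+ suc z) (ℤ.+ (4 ℕ.^ suc z)) (ℤ.+ (4 ℕ.^ suc z)) (suc z !) (z !) {{suc z ℕ.!≢0}} {{z ℕ.!≢0}}
    (trans (cancel (ℤ.+ suc z) (ℤ.+ (4 ℕ.^ suc z)) (ℤ.+ (z !))) (cong (ℤ.+ (4 ℕ.^ suc z) *_) (sym (ℤ.pos-* (suc z) (z !))))))
  (sym (fromℤ-*-/ (ℤ.+ 4) (ℤ.+ (4 ℕ.^ z)) (ℤ.+ (4 ℕ.^ suc z)) (z !) (z !) {{z ℕ.!≢0}} {{z ℕ.!≢0}}
    (cong (_* ℤ.+ (z !)) (sym (ℤ.pos-* 4 (4 ℕ.^ z))))))
  where
  cancel : ∀ k i f → k * i * f ≡ i * (k * f)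
  cancel = solve-∀

series : ℕ → (ℕ → ℤ) → ℚ
series k f = ∑ℚ (upTo k) (λ z → 4^ z /! ℚ.* fromℤ (f z))

∑ℚ-∷ʳ : (xs : List A) (y : A) (f : A → ℚ) → ∑ℚ (xs ∷ʳ y) f ≡ ∑ℚ xs f ℚ.+ f y
∑ℚ-∷ʳ []       y f = trans (ℚ.+-identityʳ (f y)) (sym (ℚ.+-identityˡ (f y)))
∑ℚ-∷ʳ (x ∷ xs) y f = trans (cong (f x ℚ.+_) (∑ℚ-∷ʳ xs y f)) (sym (ℚ.+-assoc (f x) (∑ℚ xs f) (f y)))

series-suc : ∀ k f → series (suc k) f ≡ series k f ℚ.+ 4^ k /! ℚ.* fromℤ (f k)
series-suc k f = trans (cong (λ xs → ∑ℚ xs term) (sym (upTo-∷ʳ k))) (∑ℚ-∷ʳ (upTo k) k term)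
  where
  term : ℕ → ℚ
  term z = 4^ z /! ℚ.* fromℤ (f z)

series-cong : ∀ k {f g : ℕ → ℤ} → (∀ z → f z ≡ g z) → series k f ≡ series k g
series-cong zero    eq = refl
series-cong (suc k) {f} {g} eq = trans (series-suc k f) (trans
  (cong₂ (λ x y → x ℚ.+ 4^ k /! ℚ.* fromℤ y) (series-cong k eq) (eq k)) (sym (series-suc k g)))

series-last : ∀ k {f : ℕ → ℤ} → f k ≡ 0ℤ → series (suc k) f ≡ series k f
series-last k {f} fk≡0 = trans (series-suc k f) (trans
  (cong (series k f ℚ.+_) (trans (cong (λ x → 4^ k /! ℚ.* fromℤ x) fk≡0) (ℚ.*-zeroʳ (4^ k /!))))
  (ℚ.+-identityʳ (series k f)))

series-zero : ∀ k {f : ℕ → ℤ} → (∀ z → f z ≡ 0ℤ) → series k f ≡ 0ℚ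
series-zero zero    eq = refl
series-zero (suc k) {f} eq = trans (series-last k {f} (eq k)) (series-zero k eq)

series-+ : ∀ k (f g : ℕ → ℤ) → series k (λ z → f z + g z) ≡ series k f ℚ.+ series k g
series-+ zero    f g = refl
series-+ (suc k) f g = begin
  series (suc k) (λ z → f z + g z)
    ≡⟨ series-suc k (λ z → f z + g z) ⟩
  series k (λ z → f z + g z) ℚ.+ w ℚ.* fromℤ (f k + g k)
    ≡⟨ cong₂ ℚ._+_ (series-+ k f g) (trans (cong (w ℚ.*_) (fromℤ-+ (f k) (g k))) (ℚ.*-distribˡ-+ w (fromℤ (f k)) (fromℤ (g k)))) ⟩
  (series k f ℚ.+ series k g) ℚ.+ (w ℚ.* fromℤ (f k) ℚ.+ w ℚ.* fromℤ (g k))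
    ≡⟨ ℚ+.interchange (series k f) (series k g) (w ℚ.* fromℤ (f k)) (w ℚ.* fromℤ (g k)) ⟩
  (series k f ℚ.+ w ℚ.* fromℤ (f k)) ℚ.+ (series k g ℚ.+ w ℚ.* fromℤ (g k))
    ≡⟨ cong₂ ℚ._+_ (series-suc k f) (series-suc k g) ⟨
  series (suc k) f ℚ.+ series (suc k) g
    ∎
  where
  open ≡-Reasoning
  w : ℚ
  w = 4^ k /!

series-* : ∀ k c (f : ℕ → ℤ) → series k (λ z → c * f z) ≡ fromℤ c ℚ.* series k f
series-* zero    c f = sym (ℚ.*-zeroʳ (fromℤ c))
series-* (suc k) c f = begin
  series (suc k) (λ z → c * f z)
    ≡⟨ series-suc k (λ z → c * f z) ⟩
  series k (λ z → c * f z) ℚ.+ w ℚ.* fromℤ (c * f k)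
    ≡⟨ cong₂ ℚ._+_ (series-* k c f) (trans (cong (w ℚ.*_) (fromℤ-* c (f k))) (ℚ*.x∙yz≈y∙xz w (fromℤ c) (fromℤ (f k)))) ⟩
  fromℤ c ℚ.* series k f ℚ.+ fromℤ c ℚ.* (w ℚ.* fromℤ (f k))
    ≡⟨ ℚ.*-distribˡ-+ (fromℤ c) (series k f) (w ℚ.* fromℤ (f k)) ⟨
  fromℤ c ℚ.* (series k f ℚ.+ w ℚ.* fromℤ (f k))
    ≡⟨ cong (fromℤ c ℚ.*_) (series-suc k f) ⟨
  fromℤ c ℚ.* series (suc k) f
    ∎
  where
  open ≡-Reasoning
  w : ℚ
  w = 4^ k /!

-- The alternative `c x ≡ 0ℤ` means that values are needed only where the coefficient survives, that
-- is, for lists that really are cycles in the current vertex set.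
series-∑ : ∀ k (xs : List A) (c a : A → ℤ) (f : A → ℕ → ℤ) →
  (∀ x → c x ≡ 0ℤ ⊎ series k (f x) ≡ fromℤ (a x)) →
  series k (λ z → ∑ℤ xs (λ x → c x * f x z)) ≡ fromℤ (∑ℤ xs (λ x → c x * a x))
series-∑ k []       c a f eq = series-zero k (λ _ → refl)
series-∑ k (x ∷ xs) c a f eq = trans
  (series-+ k (λ z → c x * f x z) (λ z → ∑ℤ xs (λ x → c x * f x z)))
  (trans (cong₂ ℚ._+_ (go (eq x)) (series-∑ k xs c a f eq)) (sym (fromℤ-+ (c x * a x) (∑ℤ xs (λ x → c x * a x)))))
  where
  go : c x ≡ 0ℤ ⊎ series k (f x) ≡ fromℤ (a x) → series k (λ z → c x * f x z) ≡ fromℤ (c x * a x)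
  go (inj₁ c≡0) = trans (series-zero k (λ z → cong (_* f x z) c≡0)) (cong (λ y → fromℤ (y * a x)) (sym c≡0))
  go (inj₂ eq)  = trans (series-* k (c x) (f x)) (trans (cong (fromℤ (c x) ℚ.*_) eq) (sym (fromℤ-* (c x) (a x))))

-- The term at 0 drops out and `weight-suc` moves every other term down by one, so the new series is
-- one term shorter.
series-shift : ∀ k (f g : ℕ → ℤ) → f 0 ≡ 0ℤ → (∀ z → f (suc z) ≡ ℤ.+ suc z * g z) →
               series (suc k) f ≡ series k (λ z → ℤ.+ 4 * g z)
series-shift zero    f g f0 fs = series-last 0 {f} f0
series-shift (suc k) f g f0 fs = begin
  series (suc (suc k)) f
    ≡⟨ series-suc (suc k) f ⟩
  series (suc k) f ℚ.+ 4^ suc k /! ℚ.* fromℤ (f (suc k))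
    ≡⟨ cong₂ ℚ._+_ (series-shift k f g f0 fs) step ⟩
  series k (λ z → ℤ.+ 4 * g z) ℚ.+ 4^ k /! ℚ.* fromℤ (ℤ.+ 4 * g k)
    ≡⟨ series-suc k (λ z → ℤ.+ 4 * g z) ⟨
  series (suc k) (λ z → ℤ.+ 4 * g z)
    ∎
  where
  open ≡-Reasoning
  absorb : ∀ w i → w ℚ.* fromℤ (i * g k) ≡ (fromℤ i ℚ.* w) ℚ.* fromℤ (g k)
  absorb w i = trans (cong (w ℚ.*_) (fromℤ-* i (g k))) (trans (sym (ℚ.*-assoc w (fromℤ i) (fromℤ (g k))))
    (cong (ℚ._* fromℤ (g k)) (ℚ.*-comm w (fromℤ i))))
  step : 4^ suc k /! ℚ.* fromℤ (f (suc k)) ≡ 4^ k /! ℚ.* fromℤ (ℤ.+ 4 * g k)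
  step = trans (cong (λ x → 4^ suc k /! ℚ.* fromℤ x) (fs k)) (trans (absorb (4^ suc k /!) (ℤ.+ suc k))
    (trans (cong (ℚ._* fromℤ (g k)) (weight-suc k)) (sym (absorb (4^ k /!) (ℤ.+ 4)))))

-- The quotient is rounded down, so the sign also makes sense for an odd number of vertices.
-- Removing a cycle changes that number by an even amount, and the rounding does no harm.
halfSign : ℕ → ℤ
halfSign k = -1ℤ ℤ.^ (k / 2)

halfSign-+2 : ∀ k → halfSign (2 ℕ.+ k) ≡ - halfSign k
halfSign-+2 k = trans (cong (-1ℤ ℤ.^_) (ℕ.m/n≡1+[m∸n]/n {2 ℕ.+ k} {2} (s≤s (s≤s z≤n)))) (ℤ.-1*i≡-i (halfSign k))

halfSign-square : ∀ k → halfSign k * halfSign k ≡ 1ℤ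
halfSign-square k = trans (sym (ℤ.^-distribˡ-+-* -1ℤ (k / 2) (k / 2)))
  (-1^even (divides (k / 2) (trans (cong (k / 2 ℕ.+_) (sym (ℕ.+-identityʳ (k / 2)))) (ℕ.*-comm 2 (k / 2)))))

-- The first factor is (-1)ʲ. Adding 4 to the length changes neither the divisibility by 4 nor the
-- sign, so the induction proceeds in steps of two.
halfSign-even : ∀ j k → (ℤ.+ 2 * 𝟙 (4 ∣? (j ℕ.* 2)) + -1ℤ) * halfSign k ≡ halfSign (j ℕ.* 2 ℕ.+ k)
halfSign-even zero          k = ℤ.*-identityˡ (halfSign k)
halfSign-even (suc zero)    k = trans (ℤ.-1*i≡-i (halfSign k)) (sym (halfSign-+2 k))
halfSign-even (suc (suc j)) k = trans
  (cong (λ x → (ℤ.+ 2 * x + -1ℤ) * halfSign k) (𝟙-cong (4 ∣? (4 ℕ.+ j ℕ.* 2)) (4 ∣? (j ℕ.* 2))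
    (λ 4∣ → ∣m+n∣m⇒∣n 4∣ ∣-refl) (∣m∣n⇒∣m+n ∣-refl)))
  (trans (halfSign-even j k) (sym (trans (halfSign-+2 (2 ℕ.+ (j ℕ.* 2 ℕ.+ k)))
    (trans (cong -_ (halfSign-+2 (j ℕ.* 2 ℕ.+ k))) (ℤ.neg-involutive _)))))

-- The recursion for the weighted series and the induction on the vertex set

module _ {n : ℕ} (G : Graph n) where

  tupleSum-[] : ∀ z → tupleSum G (suc z) [] ≡ 0ℤ
  tupleSum-[] z = ∑-zero (4kCycles G) (λ {R} R∈ → 𝟙-*-no (R ⊑? []) (nonempty R (4kCycles-sound G R∈)) (tupleSum G z []))
    where
    nonempty : ∀ R → Is4kCycle G R → ¬ (R ⊑ [])
    nonempty (v ∷ p) _ (() ∷ _)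

  length-remove : ∀ {v p T} → Unique T → IsCycle G (v ∷ p) → (v ∷ p) ⊑ T →
                  length T ≡ suc (length p) ℕ.+ length (T ∖ (v ∷ p))
  length-remove uT (u , _) C⊑T = length-∖ uT u C⊑T

  shorter : ∀ {v p T k} → Unique T → IsCycle G (v ∷ p) → (v ∷ p) ⊑ T → length T ≤ suc k → length (T ∖ (v ∷ p)) ≤ k
  shorter {p = p} uT cyc C⊑T len = ℕ.≤-trans (ℕ.m≤n+m _ (length p))
    (ℕ.≤-pred (subst (_≤ suc _) (length-remove uT cyc C⊑T) len))

  -- Removing a cycle of even length keeps the number of vertices odd, so every term of the cycle
  -- expansion vanishes by induction, and the empty set is never reached.
  perOn-odd : Bipartite G → ∀ k {T} → Unique T → length T ≤ k → ¬ (2 ∣ length T) → perOn G T ≡ 0ℤ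
  perOn-odd bip k       {[]}    u len odd = contradiction (2 ∣0) odd
  perOn-odd bip (suc k) {v ∷ S} u len odd = trans (perOn-cycles G u (ℕ.<⇒≤ (length-Unique u)))
    (∑-zero (listsUpTo n n) (λ {p} _ → trans
      (𝟙-*-cong (isCycle? G (v ∷ p)) (λ cyc → 𝟙-*-cong ((v ∷ p) ⊑? (v ∷ S)) (λ C⊑T →
        perOn-odd bip k (∖-unique (v ∷ p) u) (shorter u cyc C⊑T len)
          (λ even → odd (subst (2 ∣_) (sym (length-remove u cyc C⊑T)) (∣m∣n⇒∣m+n (closed-even G bip cyc) even))))))
      (trans (cong (𝟙 (isCycle? G (v ∷ p)) *_) (ℤ.*-zeroʳ (𝟙 ((v ∷ p) ⊑? (v ∷ S))))) (ℤ.*-zeroʳ (𝟙 (isCycle? G (v ∷ p)))))))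

  module _ (bip : Bipartite G) {m : ℕ} (atMost : AtMostDisjoint4kCycles G m) where

    -- The recursion for F of the overview, with the coefficient 2 · [4k-cycle] - [cycle] and with
    -- all sums cut off at `m`.
    series-step : ∀ {v S} → Unique (v ∷ S) →
      series (suc m) (λ z → tupleSum G z (v ∷ S)) ≡
      series (suc m) (λ z → ∑ℤ (listsUpTo n n) (λ p →
        ((ℤ.+ 2 * 𝟙 (is4kCycle? G (v ∷ p)) + - 𝟙 (isCycle? G (v ∷ p))) * 𝟙 ((v ∷ p) ⊑? (v ∷ S))) *
        tupleSum G z ((v ∷ S) ∖ (v ∷ p))))
    series-step {v} {S} u = begin
      series (suc m) (λ z → tupleSum G z T)
        -- A vanishing term at `suc m` is added first, because `series-shift` costs one term;
        -- afterwards both parts end at `m` again.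
        ≡⟨ series-last (suc m) {λ z → tupleSum G z T} (tupleSum-vanishes G atMost T) ⟨
      series (2 ℕ.+ m) (λ z → tupleSum G z T)
        ≡⟨ series-cong (2 ℕ.+ m) (λ z → tupleSum-cycles G bip z u (ℕ.<⇒≤ (length-Unique u))) ⟩
      series (2 ℕ.+ m) (λ z → chosenThrough G z v T + walked z)
        ≡⟨ series-+ (2 ℕ.+ m) (λ z → chosenThrough G z v T) walked ⟩
      series (2 ℕ.+ m) (λ z → chosenThrough G z v T) ℚ.+ series (2 ℕ.+ m) walked
        ≡⟨ cong₂ ℚ._+_ (series-shift (suc m) (λ z → chosenThrough G z v T) (λ z → throughSum G z v T) refl (λ z → refl))
                       (series-last (suc m) {walked} walked-vanishes) ⟩
      series (suc m) (λ z → ℤ.+ 4 * throughSum G z v T) ℚ.+ series (suc m) walked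
        ≡⟨ series-+ (suc m) (λ z → ℤ.+ 4 * throughSum G z v T) walked ⟨
      series (suc m) (λ z → ℤ.+ 4 * throughSum G z v T + walked z)
        ≡⟨ series-cong (suc m) collect ⟩
      series (suc m) (λ z → ∑ℤ U (λ p → ((ℤ.+ 2 * 4k p + - cyc p) * in-T p) * tupleSum G z (T ∖ (v ∷ p))))
        ∎
      where
      open ≡-Reasoning
      T : List (Fin n)
      T = v ∷ S
      U : List (List (Fin n))
      U = listsUpTo n n
      4k cyc in-T : List (Fin n) → ℤ
      4k p   = 𝟙 (is4kCycle? G (v ∷ p))
      cyc p  = 𝟙 (isCycle? G (v ∷ p))
      in-T p = 𝟙 ((v ∷ p) ⊑? T)
      walked : ℕ → ℤ
      walked z = - cycleSum G v T (tupleSum G z)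
      walked-vanishes : walked (suc m) ≡ 0ℤ
      walked-vanishes = cong -_ (∑-zero U (λ {p} _ → trans
        (cong (λ x → cyc p * (in-T p * x)) (tupleSum-vanishes G atMost (T ∖ (v ∷ p))))
        (trans (cong (cyc p *_) (ℤ.*-zeroʳ (in-T p))) (ℤ.*-zeroʳ (cyc p)))))
      collect : ∀ z → ℤ.+ 4 * throughSum G z v T + walked z ≡
                ∑ℤ U (λ p → ((ℤ.+ 2 * 4k p + - cyc p) * in-T p) * tupleSum G z (T ∖ (v ∷ p)))
      collect z = begin
        ℤ.+ 4 * throughSum G z v T + walked z
          -- The 4 is split as 2 · 2: one factor 2 turns undirected 4k-cycles into directed ones,
          -- the other stays in the coefficient.
          ≡⟨ split (throughSum G z v T) (cycleSum G v T (tupleSum G z)) ⟩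
        ℤ.+ 2 * (ℤ.+ 2 * throughSum G z v T) + -1ℤ * cycleSum G v T (tupleSum G z)
          ≡⟨ cong₂ _+_ (trans (cong (ℤ.+ 2 *_) (sym (throughSum-traversals G z v T))) (sym (∑-* (ℤ.+ 2) U (λ p → 4k p * (in-T p * f p)))))
                       (sym (∑-* -1ℤ U (λ p → cyc p * (in-T p * f p)))) ⟩
        ∑ℤ U (λ p → ℤ.+ 2 * (4k p * (in-T p * f p))) + ∑ℤ U (λ p → -1ℤ * (cyc p * (in-T p * f p)))
          ≡⟨ ∑-+ U (λ p → ℤ.+ 2 * (4k p * (in-T p * f p))) (λ p → -1ℤ * (cyc p * (in-T p * f p))) ⟨
        ∑ℤ U (λ p → ℤ.+ 2 * (4k p * (in-T p * f p)) + -1ℤ * (cyc p * (in-T p * f p)))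
          ≡⟨ ∑-cong U (λ p → factor (4k p) (cyc p) (in-T p) (f p)) ⟩
        ∑ℤ U (λ p → ((ℤ.+ 2 * 4k p + - cyc p) * in-T p) * f p)
          ∎
        where
        f : List (Fin n) → ℤ
        f p = tupleSum G z (T ∖ (v ∷ p))
        split : ∀ b c → ℤ.+ 4 * b + - c ≡ ℤ.+ 2 * (ℤ.+ 2 * b) + -1ℤ * c
        split = solve-∀
        factor : ∀ k c i x → ℤ.+ 2 * (k * (i * x)) + -1ℤ * (c * (i * x)) ≡ ((ℤ.+ 2 * k + - c) * i) * x
        factor = solve-∀

    -- Both sides satisfy the same recursion along the cycles through the first vertex. A cycle
    -- removes several vertices at once, so the induction is on a bound `k` for the length.
    series-perOn : ∀ k {T} → Unique T → length T ≤ k →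
                   series (suc m) (λ z → tupleSum G z T) ≡ fromℤ (halfSign (length T) * perOn G T)
    series-perOn k {[]} u len = trans (series-suc-[] m) refl
      where
      -- On the empty set only z = 0 contributes, and the empty minor is 1.
      series-suc-[] : ∀ m → series (suc m) (λ z → tupleSum G z []) ≡ fromℤ 1ℤ
      series-suc-[] zero    = refl
      series-suc-[] (suc m) = trans (series-last (suc m) {λ z → tupleSum G z []} (tupleSum-[] m)) (series-suc-[] m)
    series-perOn (suc k) {v ∷ S} u len = begin
      series (suc m) (λ z → tupleSum G z T)
        ≡⟨ series-step u ⟩
      series (suc m) (λ z → ∑ℤ U (λ p → coeff p * tupleSum G z (T ∖ (v ∷ p))))
        ≡⟨ series-∑ (suc m) U coeff value (λ p z → tupleSum G z (T ∖ (v ∷ p))) IH ⟩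
      fromℤ (∑ℤ U (λ p → coeff p * value p))
        ≡⟨ cong fromℤ (trans (∑-cong U sign) (∑-* (halfSign (length T)) U (λ p → 𝟙 (isCycle? G (v ∷ p)) * (𝟙 ((v ∷ p) ⊑? T) * perOn G (T ∖ (v ∷ p)))))) ⟩
      fromℤ (halfSign (length T) * cycleSum G v T (perOn G))
        ≡⟨ cong (λ x → fromℤ (halfSign (length T) * x)) (perOn-cycles G u (ℕ.<⇒≤ (length-Unique u))) ⟨
      fromℤ (halfSign (length T) * perOn G T)
        ∎
      where
      open ≡-Reasoning
      T : List (Fin n)
      T = v ∷ S
      U : List (List (Fin n))
      U = listsUpTo n n
      coeff value : List (Fin n) → ℤ
      coeff p = (ℤ.+ 2 * 𝟙 (is4kCycle? G (v ∷ p)) + - 𝟙 (isCycle? G (v ∷ p))) * 𝟙 ((v ∷ p) ⊑? T)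
      value p = halfSign (length (T ∖ (v ∷ p))) * perOn G (T ∖ (v ∷ p))
      coeff≡ : ∀ p → coeff p ≡ 𝟙 (isCycle? G (v ∷ p)) * (𝟙 ((v ∷ p) ⊑? T) * (ℤ.+ 2 * 𝟙 (4 ∣? length (v ∷ p)) + -1ℤ))
      coeff≡ p = trans (cong (λ x → (ℤ.+ 2 * x + - 𝟙 (isCycle? G (v ∷ p))) * 𝟙 ((v ∷ p) ⊑? T)) (𝟙-× (isCycle? G (v ∷ p)) (4 ∣? length (v ∷ p))))
        (factor (𝟙 (isCycle? G (v ∷ p))) (𝟙 (4 ∣? length (v ∷ p))) (𝟙 ((v ∷ p) ⊑? T)))
        where
        factor : ∀ y f i → (ℤ.+ 2 * (y * f) + - y) * i ≡ y * (i * (ℤ.+ 2 * f + -1ℤ))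
        factor = solve-∀
      IH : ∀ p → coeff p ≡ 0ℤ ⊎ series (suc m) (λ z → tupleSum G z (T ∖ (v ∷ p))) ≡ fromℤ (value p)
      IH p = go (isCycle? G (v ∷ p) ×-dec ((v ∷ p) ⊑? T))
        where
        go : Dec (IsCycle G (v ∷ p) × (v ∷ p) ⊑ T) → coeff p ≡ 0ℤ ⊎ series (suc m) (λ z → tupleSum G z (T ∖ (v ∷ p))) ≡ fromℤ (value p)
        go (yes (cyc , C⊑T)) = inj₂ (series-perOn k (∖-unique (v ∷ p) u) (shorter u cyc C⊑T len))
        go (no ¬both) = inj₁ (trans (coeff≡ p) (trans
          (𝟙-*-cong (isCycle? G (v ∷ p)) (λ cyc → 𝟙-*-no ((v ∷ p) ⊑? T) (λ C⊑T → ¬both (cyc , C⊑T)) (ℤ.+ 2 * 𝟙 (4 ∣? length (v ∷ p)) + -1ℤ)))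
          (ℤ.*-zeroʳ (𝟙 (isCycle? G (v ∷ p))))))
      sign : ∀ p → coeff p * value p ≡ halfSign (length T) * (𝟙 (isCycle? G (v ∷ p)) * (𝟙 ((v ∷ p) ⊑? T) * perOn G (T ∖ (v ∷ p))))
      sign p = begin
        coeff p * value p
          ≡⟨ cong (_* value p) (coeff≡ p) ⟩
        𝟙 (isCycle? G (v ∷ p)) * (𝟙 ((v ∷ p) ⊑? T) * ε) * value p
          -- The coefficient `ε` of a cycle is brought next to the sign of the remaining vertices;
          -- by `halfSign-even` their product is the sign of the whole set `T`.
          ≡⟨ gather (𝟙 (isCycle? G (v ∷ p))) (𝟙 ((v ∷ p) ⊑? T)) ε (halfSign (length (T ∖ (v ∷ p)))) (perOn G (T ∖ (v ∷ p))) ⟩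
        𝟙 (isCycle? G (v ∷ p)) * (𝟙 ((v ∷ p) ⊑? T) * ((ε * halfSign (length (T ∖ (v ∷ p)))) * perOn G (T ∖ (v ∷ p))))
          ≡⟨ 𝟙-*-cong (isCycle? G (v ∷ p)) (λ cyc → 𝟙-*-cong ((v ∷ p) ⊑? T) (λ C⊑T →
               cong (_* perOn G (T ∖ (v ∷ p))) (trans (even-sign (closed-even G bip cyc)) (cong halfSign (sym (length-remove u cyc C⊑T)))))) ⟩
        𝟙 (isCycle? G (v ∷ p)) * (𝟙 ((v ∷ p) ⊑? T) * (halfSign (length T) * perOn G (T ∖ (v ∷ p))))
          ≡⟨ pull (𝟙 (isCycle? G (v ∷ p))) (𝟙 ((v ∷ p) ⊑? T)) (halfSign (length T)) (perOn G (T ∖ (v ∷ p))) ⟩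
        halfSign (length T) * (𝟙 (isCycle? G (v ∷ p)) * (𝟙 ((v ∷ p) ⊑? T) * perOn G (T ∖ (v ∷ p))))
          ∎
        where
        ε : ℤ
        ε = ℤ.+ 2 * 𝟙 (4 ∣? length (v ∷ p)) + -1ℤ
        even-sign : 2 ∣ length (v ∷ p) → ε * halfSign (length (T ∖ (v ∷ p))) ≡ halfSign (length (v ∷ p) ℕ.+ length (T ∖ (v ∷ p)))
        even-sign (divides j eq) = subst
          (λ l → (ℤ.+ 2 * 𝟙 (4 ∣? l) + -1ℤ) * halfSign (length (T ∖ (v ∷ p))) ≡ halfSign (l ℕ.+ length (T ∖ (v ∷ p))))
          (sym eq) (halfSign-even j (length (T ∖ (v ∷ p))))
        gather : ∀ y i e h x → y * (i * e) * (h * x) ≡ y * (i * ((e * h) * x))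
        gather = solve-∀
        pull : ∀ y i h x → y * (i * (h * x)) ≡ h * (y * (i * x))
        pull = solve-∀

theorem1 : (n : ℕ) (G : Graph n) → Bipartite G →
    (m : ℕ) → AtMostDisjoint4kCycles G m →
    (2 ∣ n →
    fromℤ (perG G) ≡
    fromℤ (-1ℤ ℤ.^ (n / 2)) ℚ.*
    ∑ℚ (upTo (suc m)) (λ z →
    4^ z /! ℚ.* fromℤ (∑ℤ (disjointTuples G z) (λ T → det-∖ G T))))
    × (¬ (2 ∣ n) → perG G ≡ 0ℤ)
theorem1 n G bip m atMost = (λ _ → sym even) , odd
  where
  open ≡-Reasoning
  V : List (Fin n)
  V = allFin n
  length-V : length V ≡ n
  length-V = length-tabulate id
  even : fromℤ (halfSign n) ℚ.* series (suc m) (λ z → ∑ℤ (disjointTuples G z) (det-∖ G)) ≡ fromℤ (perG G)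
  even = begin
    fromℤ (halfSign n) ℚ.* series (suc m) (λ z → ∑ℤ (disjointTuples G z) (det-∖ G))
      ≡⟨ cong (fromℤ (halfSign n) ℚ.*_) (series-cong (suc m) (disjointTuples-∑ G)) ⟩
    fromℤ (halfSign n) ℚ.* series (suc m) (λ z → tupleSum G z V)
      ≡⟨ cong (fromℤ (halfSign n) ℚ.*_) (series-perOn G bip atMost n (allFin⁺ n) (ℕ.≤-reflexive length-V)) ⟩
    fromℤ (halfSign n) ℚ.* fromℤ (halfSign (length V) * perOn G V)
      ≡⟨ cong (λ l → fromℤ (halfSign n) ℚ.* fromℤ (halfSign l * perOn G V)) length-V ⟩
    fromℤ (halfSign n) ℚ.* fromℤ (halfSign n * perOn G V)
      ≡⟨ fromℤ-* (halfSign n) (halfSign n * perOn G V) ⟨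
    fromℤ (halfSign n * (halfSign n * perOn G V))
      -- In `series-perOn` the sign stands with the permanent; multiplying by it once more removes
      -- it, as it squares to 1.
      ≡⟨ cong fromℤ (trans (sym (ℤ.*-assoc (halfSign n) (halfSign n) (perOn G V)))
           (trans (cong (_* perOn G V) (halfSign-square n)) (ℤ.*-identityˡ (perOn G V)))) ⟩
    fromℤ (perOn G V)
      ≡⟨ cong fromℤ (per≡minor (adj G)) ⟨
    fromℤ (perG G)
      ∎
  odd : ¬ (2 ∣ n) → perG G ≡ 0ℤ
  odd ¬2∣n = trans (per≡minor (adj G))
    (perOn-odd G bip n (allFin⁺ n) (ℕ.≤-reflexive length-V) (¬2∣n ∘ subst (2 ∣_) length-V))
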